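{- For every $D \in \mathbb{N}$ and $\epsilon>0$, there is a streaming algorithm which $(1/2-\epsilon)$-approximates the $\mathsf{Max}\text{ - }\mathsf{DICUT}$ value of an $n$-vertex graph with maximum degree at most $D$ in $O(n^{1-\Omega(1)})$ space using a single, adversarially-ordered pass over the list of edges. (The constants hidden in $O(\cdot)$ and $\Omega(\cdot)$ may depend on $\epsilon$ and $D$.)
   Context: A graph is a directed multigraph $G=(V,E)$: $V$ is a finite set and $E$ is a finite multiset of ordered pairs $(u,v)$ with $u\neq v$. The degree of a vertex is the number of edges (counted with multiplicity) incident to it, in either direction; maximum degree at most $D$ means every vertex has degree at most $D$. For $x:V\to[0,1]$, $\mathrm{val}_G(x)=\frac{1}{|E|}\sum_{(u,v)\in E} x(u)(1-x(v))$ (sum with multiplicity), and the $\mathsf{Max}\text{ - }\mathsf{DICUT}$ value is $\mathrm{maxval}(G)=\max_{x:V\to\{0,1\}}\mathrm{val}_G(x)$. An algorithm $\alpha$-approximates $\mathrm{maxval}(G)$ if it outputs a value in $[\alpha\cdot \mathrm{maxval}(G),\mathrm{maxval}(G)]$. In the streaming model the edges of $G$ are presented one at a time as a stream; in an adversarially-ordered pass the order is arbitrary (worst case). Streaming algorithms may be randomized and, by the paper's convention, must succeed with probability at least $99\%$ over their internal randomness for every input. -}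

module Defs where

open import Data.Bool using (Bool; true; false; if_then_else_)
open import Data.Nat as ℕ using (ℕ; zero; suc; _+_; _*_; _^_; _⊔_)
open import Data.Fin using (Fin; _≟_)
open import Data.Fin.Properties using () renaming (_≟_ to _≟ᶠ_)
open import Data.Integer using (+_)
open import Data.List using (List; []; _∷_; length; map; foldr; filter; concatMap)
open import Data.List.Relation.Unary.All using (All)
open import Data.Vec using (Vec; []; _∷_)
open import Data.Product using (_×_; _,_; proj₁; proj₂)
open import Data.Rational using (ℚ; _/_; 0ℚ; _≤_)
open import Data.Rational.Properties using (_≤?_)
open import Relation.Nullary using (¬_; Dec; yes; no)
open import Relation.Nullary.Decidable using (⌊_⌋; _×-dec_)
open import Relation.Binary.PropositionalEquality using (_≡_)

Edge : ℕ → Set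
Edge n = Fin n × Fin n

-- A directed multigraph on Fin n is given by its edge multiset, represented
-- as a list (multiplicities = repetitions); the list order is also the stream order.
-- Loops are forbidden.
NoLoops : {n : ℕ} → List (Edge n) → Set
NoLoops = All (λ e → ¬ (proj₁ e ≡ proj₂ e))

count : {A : Set} → (A → Bool) → List A → ℕ
count p []       = 0
count p (x ∷ xs) = (if p x then 1 else 0) + count p xs

-- degree of v: number of edges incident to v (in either direction), with multiplicity
-- (no loops, so each edge contributes at most 1)
degree : {n : ℕ} → List (Edge n) → Fin n → ℕ
degree E v = count (λ e → ⌊ proj₁ e ≟ᶠ v ⌋ Data.Bool.∨ ⌊ proj₂ e ≟ᶠ v ⌋) E
  where import Data.Bool

MaxDegreeAtMost : {n : ℕ} → ℕ → List (Edge n) → Set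
MaxDegreeAtMost D E = ∀ v → degree E v ℕ.≤ D

cutCount : {n : ℕ} → (Fin n → Bool) → List (Edge n) → ℕ
cutCount x = count (λ e → cutBit (x (proj₁ e)) (x (proj₂ e)))
  where
  cutBit : Bool → Bool → Bool
  cutBit true false = true
  cutBit _    _     = false

allAssignments : (n : ℕ) → List (Fin n → Bool)
allAssignments zero    = (λ ()) ∷ []
allAssignments (suc n) =
  concatMap (λ x → (ext true x) ∷ (ext false x) ∷ []) (allAssignments n)
  where
  ext : Bool → (Fin n → Bool) → Fin (suc n) → Bool
  ext b x Fin.zero    = b
  ext b x (Fin.suc i) = x i

maxCutCount : {n : ℕ} → List (Edge n) → ℕ
maxCutCount {n} E = foldr _⊔_ 0 (map (λ x → cutCount x E) (allAssignments n))

-- maxval(G) = maxCutCount / |E|  (convention: 0 for the empty graph, where it is undefined)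
maxval : {n : ℕ} → List (Edge n) → ℚ
maxval E with length E
... | zero  = 0ℚ
... | suc m = (+ maxCutCount E) / suc m

Approximates : {n : ℕ} → ℚ → List (Edge n) → ℚ → Set
Approximates α E o = (α Data.Rational.* maxval E ≤ o) × (o ≤ maxval E)
  where import Data.Rational

approximates? : {n : ℕ} (α : ℚ) (E : List (Edge n)) (o : ℚ) → Dec (Approximates α E o)
approximates? α E o = ((α Data.Rational.* maxval E) ≤? o) ×-dec (o ≤? maxval E)
  where import Data.Rational

Bits : ℕ → Set
Bits s = Vec Bool s

allBits : (s : ℕ) → List (Bits s)
allBits zero    = [] ∷ []
allBits (suc s) = concatMap (λ w → (true ∷ w) ∷ (false ∷ w) ∷ []) (allBits s)

-- A randomized single-pass streaming algorithm on n-vertex graphs using s bits of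
-- space. It draws s uniformly random bits (the seed, counted in the space bound),
-- keeps a memory state of s bits, updates it on each edge of the stream, and at the
-- end outputs a rational number computed from the seed and the final state.
record StreamingAlg (n s : ℕ) : Set where
  field
    init   : Bits s → Bits s
    step   : Bits s → Bits s → Edge n → Bits s
    output : Bits s → Bits s → ℚ

  run : Bits s → List (Edge n) → ℚ
  run r es = output r (foldl' (init r) es)
    where
    foldl' : Bits s → List (Edge n) → Bits s
    foldl' m []       = m
    foldl' m (e ∷ es) = foldl' (step r m e) es

open StreamingAlg public

goodSeeds : {n s : ℕ} → StreamingAlg n s → ℚ → List (Edge n) → ℕ
goodSeeds {s = s} A α es =
  count (λ r → ⌊ approximates? α es (run A r es) ⌋) (allBits s)

SucceedsWhp : {n s : ℕ} → StreamingAlg n s → ℚ → List (Edge n) → Set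
SucceedsWhp {s = s} A α es = 99 * 2 ^ s ℕ.≤ 100 * goodSeeds A α es

{-# OPTIONS --safe #-}
module Submission where

-- Relax the cut value to ∑ min(x u, 1 − x v) over x in [0,1]^V. Rounding u independently with probability
-- 1/4 + x u / 2 keeps half of it, so any x whose relaxed value is at least the optimal cut minus a small
-- multiple of |E| gives a (1/2 − ε)-approximation (the optimal cut is at least |E|/4). Projected subgradient
-- ascent reaches such an x, on average over the iterates, in a number of rounds depending only on D and ε,
-- so the averaged value is a sum over the edges of a function of a ball of bounded size. Sample each vertex
-- with probability 1/b, store the edges touching the sample, and sum over the edges whose ball lies in the
-- sample, reweighted by b^|ball|: this is unbiased, and since few pairs of balls meet, Chebyshev's inequality
-- applies once |E| exceeds a large constant times a power of b; shorter streams are stored entirely. With b a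
-- small power of n both buffers are sublinear. Finally, as in Newman's theorem, 2^s fixed samples serve all
-- inputs, so that the s seed bits only have to index them.

open import Defs
import Data.Bool as Bool
open import Data.Bool using (Bool; true; false; if_then_else_; _∨_; _∧_; not)
open import Data.Bool.Properties using (T?)
open import Data.Empty using (⊥-elim)
open import Data.Fin using (Fin; zero; suc; toℕ; fromℕ<)
open import Data.Fin.Properties using (_≟_; all?; toℕ<n; fromℕ<-toℕ)
import Data.Integer as ℤ
open import Data.Integer using (+[1+_]) renaming (+_ to infix 8 ⁺_)
import Data.Integer.Properties as ℤ
open import Data.Integer.Tactic.RingSolver using () renaming (solve-∀ to solve-∀ᶻ)
open import Data.List using (List; []; _∷_; length; filter; allFin; map; _++_; take; foldr; foldl; concatMap; cartesianProduct; cartesianProductWith)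
open import Data.List.Properties using (map-tabulate; length-tabulate; length-filter; take-all; filter-++; length-++; length-map; ++-identityʳ; ++-assoc; length-++-≤ˡ)
open import Data.List.Membership.Propositional using (_∈_)
open import Data.List.Membership.Propositional.Properties using (∈-cartesianProductWith⁺; ∈-cartesianProduct⁺; ∈-allFin; ∈-filter⁺; ∈-filter⁻)
open import Data.List.Relation.Unary.Any using (here; there)
import Data.List.Relation.Unary.All as All
open import Data.List.Relation.Unary.All using ([]; _∷_)
open import Data.Maybe using (Maybe; just; nothing)
import Data.Maybe as Maybe
open import Data.Nat hiding (_≟_; _/_)
open import Data.Nat using () renaming (_≟_ to _≟ⁿ_)
open import Data.Nat.Properties hiding (_≟_)
open import Data.Nat.Tactic.RingSolver using (solve-∀)
open import Data.Product using (Σ; ∃; _×_; _,_; proj₁; proj₂)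
import Data.Rational as ℚ
open import Data.Rational using (ℚ; 0ℚ; ½; _-_; _/_; mkℚ; Positive; toℚᵘ)
import Data.Rational.Properties as ℚ
import Data.Rational.Unnormalised as ℚᵘ
import Data.Rational.Unnormalised.Properties as ℚᵘ
open import Data.Sum using (_⊎_; inj₁; inj₂)
import Data.Vec as Vec
open import Data.Vec using (Vec; []; _∷_; lookup)
open import Function using (_∘_; id)
open import Relation.Binary.PropositionalEquality
open import Relation.Nullary using (¬_; Dec; yes; no)
open import Relation.Nullary.Decidable using (⌊_⌋; ¬?; _×-dec_)

-- The error has to be a small fraction of |E|, not of n, since a sparse stream may leave most
-- vertices isolated. Two facts give this: isolated vertices never move, so the initial squared
-- distance is charged to edges, and the squared subgradients sum to at most 2 D |E|. Coordinates
-- live in {0, ..., K} and move by integers, which amounts to step size 1 / K; relative to K T |E|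
-- the regret is then K / T + D / K.
--
-- The factor 1/2 is the inequality (1/4 + z/2)² ≥ z/2, with z the relaxed value of an edge. It
-- holds for every x, so the output is safe from above without any convergence; only the lower bound
-- uses the ascent.
--
-- A sample takes n random bits, but the seed has to fit into the sublinear space bound. This forces
-- the fixed table of samples, which costs no space because `step` may be any function of the seed.

-- Sums over lists, and double counting between vertices and edges.

∑ : {A : Set} → List A → (A → ℕ) → ℕ
∑ []       f = 0
∑ (x ∷ xs) f = f x + ∑ xs f

module _ {A : Set} where

  ∑-cong-∈ : (xs : List A) {f g : A → ℕ} → (∀ {x} → x ∈ xs → f x ≡ g x) → ∑ xs f ≡ ∑ xs g
  ∑-cong-∈ []       h = refl
  ∑-cong-∈ (x ∷ xs) h = cong₂ _+_ (h (here refl)) (∑-cong-∈ xs (h ∘ there))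

  ∑-cong : (xs : List A) {f g : A → ℕ} → (∀ x → f x ≡ g x) → ∑ xs f ≡ ∑ xs g
  ∑-cong xs h = ∑-cong-∈ xs (λ {x} _ → h x)

  ∑-mono-∈ : (xs : List A) {f g : A → ℕ} → (∀ {x} → x ∈ xs → f x ≤ g x) → ∑ xs f ≤ ∑ xs g
  ∑-mono-∈ []       h = z≤n
  ∑-mono-∈ (x ∷ xs) h = +-mono-≤ (h (here refl)) (∑-mono-∈ xs (h ∘ there))

  ∑-mono : (xs : List A) {f g : A → ℕ} → (∀ x → f x ≤ g x) → ∑ xs f ≤ ∑ xs g
  ∑-mono xs h = ∑-mono-∈ xs (λ {x} _ → h x)

  ∑-+ : (xs : List A) {f g : A → ℕ} → ∑ xs (λ x → f x + g x) ≡ ∑ xs f + ∑ xs g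
  ∑-+ []       = refl
  ∑-+ (x ∷ xs) {f} {g} rewrite ∑-+ xs {f} {g} = lem (f x) (g x) (∑ xs f) (∑ xs g)
    where
    lem : ∀ a b c d → a + b + (c + d) ≡ a + c + (b + d)
    lem = solve-∀

  ∑-*ˡ : (xs : List A) (c : ℕ) {f : A → ℕ} → ∑ xs (λ x → c * f x) ≡ c * ∑ xs f
  ∑-*ˡ []       c = sym (*-zeroʳ c)
  ∑-*ˡ (x ∷ xs) c {f} rewrite ∑-*ˡ xs c {f} = sym (*-distribˡ-+ c (f x) (∑ xs f))

  ∑-*ʳ : (xs : List A) (c : ℕ) {f : A → ℕ} → ∑ xs (λ x → f x * c) ≡ ∑ xs f * c
  ∑-*ʳ xs c {f} = trans (∑-cong xs (λ x → *-comm (f x) c)) (trans (∑-*ˡ xs c) (*-comm c (∑ xs f)))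

  ∑-const : (xs : List A) (c : ℕ) → ∑ xs (λ _ → c) ≡ length xs * c
  ∑-const []       c = refl
  ∑-const (x ∷ xs) c = cong (c +_) (∑-const xs c)

  ∑-0 : (xs : List A) → ∑ xs (λ _ → 0) ≡ 0
  ∑-0 xs = trans (∑-const xs 0) (*-zeroʳ (length xs))

  ∑-≤-const : (xs : List A) {f : A → ℕ} {c : ℕ} → (∀ x → f x ≤ c) → ∑ xs f ≤ length xs * c
  ∑-≤-const xs {c = c} h = ≤-trans (∑-mono xs h) (≤-reflexive (∑-const xs c))

  ∑-∈ : {xs : List A} {x : A} (f : A → ℕ) → x ∈ xs → f x ≤ ∑ xs f
  ∑-∈ f (here refl) = m≤m+n _ _
  ∑-∈ {y ∷ xs} f (there i) = ≤-trans (∑-∈ f i) (m≤n+m _ (f y))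

  ∑-filter : {P : A → Set} (P? : ∀ x → Dec (P x)) (xs : List A) {f : A → ℕ} →
    (∀ x → ¬ P x → f x ≡ 0) → ∑ (filter P? xs) f ≡ ∑ xs f
  ∑-filter P? []       h = refl
  ∑-filter P? (x ∷ xs) {f} h with P? x
  ... | yes p = cong (f x +_) (∑-filter P? xs h)
  ... | no ¬p = trans (∑-filter P? xs h) (cong (_+ ∑ xs f) (sym (h x ¬p)))

∑-swap : {A B : Set} (xs : List A) (ys : List B) {f : A → B → ℕ} →
  ∑ xs (λ x → ∑ ys (f x)) ≡ ∑ ys (λ y → ∑ xs (λ x → f x y))
∑-swap []       ys = sym (∑-0 ys)
∑-swap (x ∷ xs) ys {f} = trans (cong (∑ ys (f x) +_) (∑-swap xs ys)) (sym (∑-+ ys))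

∑-map : {A B : Set} (h : A → B) (xs : List A) {f : B → ℕ} → ∑ (map h xs) f ≡ ∑ xs (f ∘ h)
∑-map h []       = refl
∑-map h (x ∷ xs) {f} = cong (f (h x) +_) (∑-map h xs)

⟦_⟧ : Bool → ℕ
⟦ b ⟧ = if b then 1 else 0

∑ᵛ : {n : ℕ} → (Fin n → ℕ) → ℕ
∑ᵛ {n} = ∑ (allFin n)

∑ᵛ-suc : {n : ℕ} (f : Fin (suc n) → ℕ) → ∑ᵛ f ≡ f zero + ∑ᵛ (f ∘ suc)
∑ᵛ-suc {n} f = cong (f zero +_) (trans (cong (λ l → ∑ l f) (sym (map-tabulate id suc))) (∑-map suc (allFin n)))

δ : {n : ℕ} → Fin n → Fin n → ℕ
δ u v = ⟦ ⌊ u ≟ v ⌋ ⟧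

δ-refl : {n : ℕ} (v : Fin n) → δ v v ≡ 1
δ-refl v with v ≟ v
... | yes _ = refl
... | no ¬p = ⊥-elim (¬p refl)

δ-suc : {n : ℕ} (u v : Fin n) → δ (suc u) (suc v) ≡ δ u v
δ-suc u v with u ≟ v
... | yes p = refl
... | no _  = refl

∑ᵛ-δ : {n : ℕ} (u : Fin n) (f : Fin n → ℕ) → ∑ᵛ (λ v → δ u v * f v) ≡ f u
∑ᵛ-δ {suc n} zero f = begin
  ∑ᵛ (λ v → δ zero v * f v)        ≡⟨ ∑ᵛ-suc (λ v → δ zero v * f v) ⟩
  1 * f zero + ∑ᵛ {n} (λ _ → 0)    ≡⟨ cong₂ _+_ (*-identityˡ (f zero)) (∑-0 (allFin n)) ⟩
  f zero + 0                       ≡⟨ +-identityʳ (f zero) ⟩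
  f zero                           ∎
  where open ≡-Reasoning
∑ᵛ-δ {suc n} (suc u) f = begin
  ∑ᵛ (λ v → δ (suc u) v * f v)              ≡⟨ ∑ᵛ-suc (λ v → δ (suc u) v * f v) ⟩
  ∑ᵛ (λ v → δ (suc u) (suc v) * f (suc v))  ≡⟨ ∑-cong (allFin n) (λ v → cong (_* f (suc v)) (δ-suc u v)) ⟩
  ∑ᵛ (λ v → δ u v * f (suc v))              ≡⟨ ∑ᵛ-δ u (f ∘ suc) ⟩
  f (suc u)                                 ∎
  where open ≡-Reasoning

∑ᵛ-δ₁ : {n : ℕ} (u : Fin n) → ∑ᵛ (δ u) ≡ 1
∑ᵛ-δ₁ {n} u = trans (∑-cong (allFin n) (λ v → sym (*-identityʳ (δ u v)))) (∑ᵛ-δ u (λ _ → 1))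

-- Degrees, subgradients and the walk recursion are all sums of `ends` over the stream. One exchange
-- lemma therefore serves them all, and `Agree` can compare two streams around `v` through these
-- sums alone.
ends : {n : ℕ} → (Edge n → ℕ) → (Edge n → ℕ) → Fin n → Edge n → ℕ
ends f g v e = δ (proj₁ e) v * f e + δ (proj₂ e) v * g e

∑ᵛ-ends : {n : ℕ} (E : List (Edge n)) (f g : Edge n → ℕ) (y : Fin n → ℕ) →
  ∑ᵛ (λ v → ∑ E (ends f g v) * y v) ≡ ∑ E (λ e → f e * y (proj₁ e) + g e * y (proj₂ e))
∑ᵛ-ends {n} E f g y = begin
  ∑ᵛ (λ v → ∑ E (ends f g v) * y v)            ≡⟨ ∑-cong (allFin n) (λ v → sym (∑-*ʳ E (y v))) ⟩
  ∑ᵛ (λ v → ∑ E (λ e → ends f g v e * y v))    ≡⟨ ∑-swap (allFin n) E ⟩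
  ∑ E (λ e → ∑ᵛ (λ v → ends f g v e * y v))    ≡⟨ ∑-cong E per-edge ⟩
  ∑ E (λ e → f e * y (proj₁ e) + g e * y (proj₂ e)) ∎
  where
  open ≡-Reasoning
  shuffle : ∀ a b c d z → (a * b + c * d) * z ≡ a * (b * z) + c * (d * z)
  shuffle = solve-∀
  per-edge : ∀ e → ∑ᵛ (λ v → ends f g v e * y v) ≡ f e * y (proj₁ e) + g e * y (proj₂ e)
  per-edge e@(u , w) = begin
    ∑ᵛ (λ v → ends f g v e * y v)
      ≡⟨ ∑-cong (allFin n) (λ v → shuffle (δ u v) (f e) (δ w v) (g e) (y v)) ⟩
    ∑ᵛ (λ v → δ u v * (f e * y v) + δ w v * (g e * y v))
      ≡⟨ ∑-+ (allFin n) ⟩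
    ∑ᵛ (λ v → δ u v * (f e * y v)) + ∑ᵛ (λ v → δ w v * (g e * y v))
      ≡⟨ cong₂ _+_ (∑ᵛ-δ u (λ v → f e * y v)) (∑ᵛ-δ w (λ v → g e * y v)) ⟩
    f e * y u + g e * y w ∎

deg : {n : ℕ} → List (Edge n) → Fin n → ℕ
deg E v = ∑ E (ends (λ _ → 1) (λ _ → 1) v)

-- A loop would count twice in `deg` but once in `degree`; `NoLoops` excludes that case.
degree≡deg : {n : ℕ} (E : List (Edge n)) → NoLoops E → ∀ v → degree E v ≡ deg E v
degree≡deg []            nl       v = refl
degree≡deg ((a , b) ∷ E) (p ∷ nl) v with a ≟ v | b ≟ v
... | yes refl | yes refl = ⊥-elim (p refl)
... | yes _    | no _     = cong suc (degree≡deg E nl v)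
... | no _     | yes _    = cong suc (degree≡deg E nl v)
... | no _     | no _     = degree≡deg E nl v

∑ᵛ-deg : {n : ℕ} (E : List (Edge n)) (y : Fin n → ℕ) →
  ∑ᵛ (λ v → deg E v * y v) ≡ ∑ E (λ e → y (proj₁ e) + y (proj₂ e))
∑ᵛ-deg E y = trans (∑ᵛ-ends E (λ _ → 1) (λ _ → 1) y)
  (∑-cong E (λ e → cong₂ _+_ (*-identityˡ (y (proj₁ e))) (*-identityˡ (y (proj₂ e)))))

∑ᵛ-deg-total : {n : ℕ} (E : List (Edge n)) → ∑ᵛ (deg E) ≡ length E * 2
∑ᵛ-deg-total {n} E = begin
  ∑ᵛ (deg E)             ≡⟨ ∑-cong (allFin n) (λ v → sym (*-identityʳ (deg E v))) ⟩
  ∑ᵛ (λ v → deg E v * 1) ≡⟨ ∑ᵛ-deg E (λ _ → 1) ⟩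
  ∑ E (λ _ → 2)          ≡⟨ ∑-const E 2 ⟩
  length E * 2           ∎
  where open ≡-Reasoning

length≤n*D : {n D : ℕ} (E : List (Edge n)) → (∀ v → deg E v ≤ D) → length E ≤ n * D
length≤n*D {n} {D} E dg = begin
  length E             ≤⟨ m≤m*n (length E) 2 ⟩
  length E * 2         ≡⟨ ∑ᵛ-deg-total E ⟨
  ∑ᵛ (deg E)           ≤⟨ ∑-≤-const (allFin n) dg ⟩
  length (allFin n) * D ≡⟨ cong (_* D) (length-tabulate {n = n} id) ⟩
  n * D                ∎
  where open ≤-Reasoning

-- Expectations under product measures, without division.

-- Q ^ n times the expectation of f when coordinate i is independently true
-- with probability p i / Q and false with probability q i / Q, for p i + q i ≡ Q.
𝔼 : {n : ℕ} → (p q : Fin n → ℕ) → (Vec Bool n → ℕ) → ℕ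
𝔼 {zero}  p q f = f []
𝔼 {suc n} p q f = p zero * 𝔼 (p ∘ suc) (q ∘ suc) (f ∘ (true ∷_)) + q zero * 𝔼 (p ∘ suc) (q ∘ suc) (f ∘ (false ∷_))

𝔼-cong : {n : ℕ} {p q : Fin n → ℕ} {f g : Vec Bool n → ℕ} → (∀ S → f S ≡ g S) → 𝔼 p q f ≡ 𝔼 p q g
𝔼-cong {zero}  h = h []
𝔼-cong {suc n} {p} {q} h = cong₂ (λ a b → p zero * a + q zero * b) (𝔼-cong (h ∘ (true ∷_))) (𝔼-cong (h ∘ (false ∷_)))

𝔼-mono : {n : ℕ} {p q : Fin n → ℕ} {f g : Vec Bool n → ℕ} → (∀ S → f S ≤ g S) → 𝔼 p q f ≤ 𝔼 p q g
𝔼-mono {zero}  h = h []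
𝔼-mono {suc n} {p} {q} h = +-mono-≤ (*-monoʳ-≤ (p zero) (𝔼-mono (h ∘ (true ∷_)))) (*-monoʳ-≤ (q zero) (𝔼-mono (h ∘ (false ∷_))))

𝔼-+ : {n : ℕ} {p q : Fin n → ℕ} {f g : Vec Bool n → ℕ} → 𝔼 p q (λ S → f S + g S) ≡ 𝔼 p q f + 𝔼 p q g
𝔼-+ {zero} = refl
𝔼-+ {suc n} {p} {q} {f} {g}
  rewrite 𝔼-+ {n} {p ∘ suc} {q ∘ suc} {f ∘ (true ∷_)} {g ∘ (true ∷_)}
        | 𝔼-+ {n} {p ∘ suc} {q ∘ suc} {f ∘ (false ∷_)} {g ∘ (false ∷_)} = lem (p zero) (q zero) _ _ _ _
  where
  lem : ∀ p q a b c d → p * (a + b) + q * (c + d) ≡ p * a + q * c + (p * b + q * d)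
  lem = solve-∀

𝔼-*ˡ : {n : ℕ} {p q : Fin n → ℕ} (c : ℕ) {f : Vec Bool n → ℕ} → 𝔼 p q (λ S → c * f S) ≡ c * 𝔼 p q f
𝔼-*ˡ {zero} c = refl
𝔼-*ˡ {suc n} {p} {q} c {f}
  rewrite 𝔼-*ˡ {n} {p ∘ suc} {q ∘ suc} c {f ∘ (true ∷_)}
        | 𝔼-*ˡ {n} {p ∘ suc} {q ∘ suc} c {f ∘ (false ∷_)} = lem (p zero) (q zero) c _ _
  where
  lem : ∀ p q c a b → p * (c * a) + q * (c * b) ≡ c * (p * a + q * b)
  lem = solve-∀

𝔼-const : {n : ℕ} {p q : Fin n → ℕ} {Q : ℕ} (c : ℕ) → (∀ i → p i + q i ≡ Q) → 𝔼 p q (λ _ → c) ≡ c * Q ^ n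
𝔼-const {zero}  c h = sym (*-identityʳ c)
𝔼-const {suc n} {p} {q} {Q} c h
  rewrite 𝔼-const {n} {p ∘ suc} {q ∘ suc} {Q} c (h ∘ suc) = begin
    p zero * (c * Q ^ n) + q zero * (c * Q ^ n) ≡⟨ *-distribʳ-+ (c * Q ^ n) (p zero) (q zero) ⟨
    (p zero + q zero) * (c * Q ^ n)             ≡⟨ cong (_* (c * Q ^ n)) (h zero) ⟩
    Q * (c * Q ^ n)                             ≡⟨ lem Q c (Q ^ n) ⟩
    c * (Q * Q ^ n)                             ∎
  where
  open ≡-Reasoning
  lem : ∀ a b c → a * (b * c) ≡ b * (a * c)
  lem = solve-∀

𝔼-∑ : {A : Set} {n : ℕ} {p q : Fin n → ℕ} {Q : ℕ} → (∀ i → p i + q i ≡ Q) → (xs : List A) {f : A → Vec Bool n → ℕ} →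
  𝔼 p q (λ S → ∑ xs (λ x → f x S)) ≡ ∑ xs (λ x → 𝔼 p q (f x))
𝔼-∑ h []       = 𝔼-const 0 h
𝔼-∑ {p = p} {q} h (x ∷ xs) {f} =
  trans (𝔼-+ {p = p} {q} {f x} {λ S → ∑ xs (λ x → f x S)}) (cong (𝔼 p q (f x) +_) (𝔼-∑ h xs))

private
  weighted-≤ : ∀ p q {Q a b x} → p + q ≡ Q → x ≤ a → x ≤ b → Q * x ≤ p * a + q * b
  weighted-≤ p q {x = x} refl xa xb =
    ≤-trans (≤-reflexive (*-distribʳ-+ x p q)) (+-mono-≤ (*-monoʳ-≤ p xa) (*-monoʳ-≤ q xb))

  weighted-≥ : ∀ p q {Q a b x} → p + q ≡ Q → a ≤ x → b ≤ x → p * a + q * b ≤ Q * x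
  weighted-≥ p q {x = x} refl xa xb =
    ≤-trans (+-mono-≤ (*-monoʳ-≤ p xa) (*-monoʳ-≤ q xb)) (≤-reflexive (sym (*-distribʳ-+ x p q)))

-- Method of conditional expectations: of the points found in the two branches the better one is
-- kept, and it does at least as well as their weighted average. `Q ^ n` is the total mass.
𝔼-min : {n : ℕ} {p q : Fin n → ℕ} {Q : ℕ} → (∀ i → p i + q i ≡ Q) → (f : Vec Bool n → ℕ) →
  ∃ λ S → Q ^ n * f S ≤ 𝔼 p q f
𝔼-min {zero}  h f = [] , ≤-reflexive (*-identityˡ (f []))
𝔼-min {suc n} {p} {q} {Q} h f with 𝔼-min (h ∘ suc) (f ∘ (true ∷_)) | 𝔼-min (h ∘ suc) (f ∘ (false ∷_))
... | S , a | S′ , b with ≤-total (f (true ∷ S)) (f (false ∷ S′))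
... | inj₁ c = true ∷ S , ≤-trans (≤-reflexive (*-assoc Q (Q ^ n) _))
  (weighted-≤ (p zero) (q zero) (h zero) a (≤-trans (*-monoʳ-≤ (Q ^ n) c) b))
... | inj₂ c = false ∷ S′ , ≤-trans (≤-reflexive (*-assoc Q (Q ^ n) _))
  (weighted-≤ (p zero) (q zero) (h zero) (≤-trans (*-monoʳ-≤ (Q ^ n) c) a) b)

𝔼-max : {n : ℕ} {p q : Fin n → ℕ} {Q : ℕ} → (∀ i → p i + q i ≡ Q) → (f : Vec Bool n → ℕ) →
  ∃ λ S → 𝔼 p q f ≤ Q ^ n * f S
𝔼-max {zero}  h f = [] , ≤-reflexive (sym (*-identityˡ (f [])))
𝔼-max {suc n} {p} {q} {Q} h f with 𝔼-max (h ∘ suc) (f ∘ (true ∷_)) | 𝔼-max (h ∘ suc) (f ∘ (false ∷_))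
... | S , a | S′ , b with ≤-total (f (true ∷ S)) (f (false ∷ S′))
... | inj₁ c = false ∷ S′ , ≤-trans (weighted-≥ (p zero) (q zero) (h zero) (≤-trans a (*-monoʳ-≤ (Q ^ n) c)) b)
  (≤-reflexive (sym (*-assoc Q (Q ^ n) _)))
... | inj₂ c = true ∷ S , ≤-trans (weighted-≥ (p zero) (q zero) (h zero) a (≤-trans b (*-monoʳ-≤ (Q ^ n) c)))
  (≤-reflexive (sym (*-assoc Q (Q ^ n) _)))

𝔼-true : {n : ℕ} {p q : Fin n → ℕ} {Q : ℕ} → (∀ i → p i + q i ≡ Q) → (u : Fin n) →
  Q * 𝔼 p q (λ S → ⟦ lookup S u ⟧) ≡ Q ^ n * p u
𝔼-true {suc n} {p} {q} {Q} h zero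
  rewrite 𝔼-const {n} {p ∘ suc} {q ∘ suc} {Q} 1 (h ∘ suc) | 𝔼-const {n} {p ∘ suc} {q ∘ suc} {Q} 0 (h ∘ suc)
  = lem Q (p zero) (q zero) (Q ^ n)
  where
  lem : ∀ Q p q x → Q * (p * (1 * x) + q * 0) ≡ Q * x * p
  lem = solve-∀
𝔼-true {suc n} {p} {q} {Q} h (suc u) = begin
  Q * (p zero * X + q zero * X)   ≡⟨ cong (Q *_) (*-distribʳ-+ X (p zero) (q zero)) ⟨
  Q * ((p zero + q zero) * X)     ≡⟨ cong (λ z → Q * (z * X)) (h zero) ⟩
  Q * (Q * X)                     ≡⟨ cong (Q *_) (𝔼-true (h ∘ suc) u) ⟩
  Q * (Q ^ n * p (suc u))         ≡⟨ *-assoc Q (Q ^ n) (p (suc u)) ⟨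
  Q * Q ^ n * p (suc u)           ∎
  where
  open ≡-Reasoning
  X = 𝔼 (p ∘ suc) (q ∘ suc) (λ S → ⟦ lookup S u ⟧)

𝔼-false : {n : ℕ} {p q : Fin n → ℕ} {Q : ℕ} → (∀ i → p i + q i ≡ Q) → (u : Fin n) →
  Q * 𝔼 p q (λ S → ⟦ not (lookup S u) ⟧) ≡ Q ^ n * q u
𝔼-false {suc n} {p} {q} {Q} h zero
  rewrite 𝔼-const {n} {p ∘ suc} {q ∘ suc} {Q} 1 (h ∘ suc) | 𝔼-const {n} {p ∘ suc} {q ∘ suc} {Q} 0 (h ∘ suc)
  = lem Q (p zero) (q zero) (Q ^ n)
  where
  lem : ∀ Q p q x → Q * (p * 0 + q * (1 * x)) ≡ Q * x * q
  lem = solve-∀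
𝔼-false {suc n} {p} {q} {Q} h (suc u) = begin
  Q * (p zero * X + q zero * X)   ≡⟨ cong (Q *_) (*-distribʳ-+ X (p zero) (q zero)) ⟨
  Q * ((p zero + q zero) * X)     ≡⟨ cong (λ z → Q * (z * X)) (h zero) ⟩
  Q * (Q * X)                     ≡⟨ cong (Q *_) (𝔼-false (h ∘ suc) u) ⟩
  Q * (Q ^ n * q (suc u))         ≡⟨ *-assoc Q (Q ^ n) (q (suc u)) ⟨
  Q * Q ^ n * q (suc u)           ∎
  where
  open ≡-Reasoning
  X = 𝔼 (p ∘ suc) (q ∘ suc) (λ S → ⟦ not (lookup S u) ⟧)

cut : Bool → Bool → ℕ
cut a b = ⟦ a ⟧ * ⟦ not b ⟧

-- The two endpoints differ, so their sides are independent; the two factors `Q` clear the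
-- denominators of the two probabilities.
𝔼-cut : {n : ℕ} {p q : Fin n → ℕ} {Q : ℕ} → (∀ i → p i + q i ≡ Q) → (u v : Fin n) → ¬ (u ≡ v) →
  Q * (Q * 𝔼 p q (λ S → cut (lookup S u) (lookup S v))) ≡ Q ^ n * (p u * q v)
𝔼-cut h zero zero ne = ⊥-elim (ne refl)
𝔼-cut {suc n} {p} {q} {Q} h zero (suc v) ne = begin
  Q * (Q * (p zero * 𝔼 p′ q′ (λ S → 1 * ⟦ not (lookup S v) ⟧) + q zero * 𝔼 p′ q′ (λ S → 0)))
    ≡⟨ cong₂ (λ a b → Q * (Q * (p zero * a + q zero * b)))
         (𝔼-cong (λ S → *-identityˡ ⟦ not (lookup S v) ⟧)) (𝔼-const {n} {p′} {q′} {Q} 0 (h ∘ suc)) ⟩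
  Q * (Q * (p zero * X + q zero * 0)) ≡⟨ lem Q (p zero) (q zero) X ⟩
  Q * (p zero * (Q * X))              ≡⟨ cong (λ z → Q * (p zero * z)) (𝔼-false (h ∘ suc) v) ⟩
  Q * (p zero * (Q ^ n * q (suc v)))  ≡⟨ lem′ Q (p zero) (Q ^ n) (q (suc v)) ⟩
  Q * Q ^ n * (p zero * q (suc v))    ∎
  where
  open ≡-Reasoning
  p′ = p ∘ suc
  q′ = q ∘ suc
  X = 𝔼 p′ q′ (λ S → ⟦ not (lookup S v) ⟧)
  lem : ∀ Q p q x → Q * (Q * (p * x + q * 0)) ≡ Q * (p * (Q * x))
  lem = solve-∀
  lem′ : ∀ Q p x y → Q * (p * (x * y)) ≡ Q * x * (p * y)
  lem′ = solve-∀
𝔼-cut {suc n} {p} {q} {Q} h (suc u) zero ne = begin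
  Q * (Q * (p zero * 𝔼 p′ q′ (λ S → ⟦ lookup S u ⟧ * 0) + q zero * 𝔼 p′ q′ (λ S → ⟦ lookup S u ⟧ * 1)))
    ≡⟨ cong₂ (λ a b → Q * (Q * (p zero * a + q zero * b)))
         (trans (𝔼-cong (λ S → *-zeroʳ ⟦ lookup S u ⟧)) (𝔼-const {n} {p′} {q′} {Q} 0 (h ∘ suc)))
         (𝔼-cong (λ S → *-identityʳ ⟦ lookup S u ⟧)) ⟩
  Q * (Q * (p zero * 0 + q zero * X)) ≡⟨ lem Q (p zero) (q zero) X ⟩
  Q * (q zero * (Q * X))              ≡⟨ cong (λ z → Q * (q zero * z)) (𝔼-true (h ∘ suc) u) ⟩
  Q * (q zero * (Q ^ n * p (suc u)))  ≡⟨ lem′ Q (q zero) (Q ^ n) (p (suc u)) ⟩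
  Q * Q ^ n * (p (suc u) * q zero)    ∎
  where
  open ≡-Reasoning
  p′ = p ∘ suc
  q′ = q ∘ suc
  X = 𝔼 p′ q′ (λ S → ⟦ lookup S u ⟧)
  lem : ∀ Q p q x → Q * (Q * (p * 0 + q * x)) ≡ Q * (q * (Q * x))
  lem = solve-∀
  lem′ : ∀ Q p x y → Q * (p * (x * y)) ≡ Q * x * (y * p)
  lem′ = solve-∀
𝔼-cut {suc n} {p} {q} {Q} h (suc u) (suc v) ne = begin
  Q * (Q * (p zero * X + q zero * X))   ≡⟨ cong (λ z → Q * (Q * z)) (*-distribʳ-+ X (p zero) (q zero)) ⟨
  Q * (Q * ((p zero + q zero) * X))     ≡⟨ cong (λ z → Q * (Q * (z * X))) (h zero) ⟩
  Q * (Q * (Q * X))                     ≡⟨ cong (Q *_) (𝔼-cut (h ∘ suc) u v (ne ∘ cong suc)) ⟩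
  Q * (Q ^ n * (p (suc u) * q (suc v))) ≡⟨ *-assoc Q (Q ^ n) _ ⟨
  Q * Q ^ n * (p (suc u) * q (suc v))   ∎
  where
  open ≡-Reasoning
  X = 𝔼 (p ∘ suc) (q ∘ suc) (λ S → cut (lookup S u) (lookup S v))

-- The maximum cut and independent rounding.

cutCount≡∑ : {n : ℕ} (x : Fin n → Bool) (E : List (Edge n)) →
  cutCount x E ≡ ∑ E (λ e → cut (x (proj₁ e)) (x (proj₂ e)))
cutCount≡∑ x []            = refl
cutCount≡∑ x ((u , v) ∷ E) with x u | x v
... | true  | true  = cutCount≡∑ x E
... | true  | false = cong suc (cutCount≡∑ x E)
... | false | true  = cutCount≡∑ x E
... | false | false = cutCount≡∑ x E

cutCount-cong : {n : ℕ} {x y : Fin n → Bool} (E : List (Edge n)) → (∀ i → x i ≡ y i) → cutCount x E ≡ cutCount y E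
cutCount-cong {x = x} {y} E h = begin
  cutCount x E                                    ≡⟨ cutCount≡∑ x E ⟩
  ∑ E (λ e → cut (x (proj₁ e)) (x (proj₂ e)))     ≡⟨ ∑-cong E (λ e → cong₂ cut (h (proj₁ e)) (h (proj₂ e))) ⟩
  ∑ E (λ e → cut (y (proj₁ e)) (y (proj₂ e)))     ≡⟨ cutCount≡∑ y E ⟨
  cutCount y E                                    ∎
  where open ≡-Reasoning

∈-pairs : {A B : Set} (f g : A → B) {xs : List A} {x : A} → x ∈ xs →
  (f x ∈ concatMap (λ x → f x ∷ g x ∷ []) xs) × (g x ∈ concatMap (λ x → f x ∷ g x ∷ []) xs)
∈-pairs f g (here refl) = here refl , there (here refl)
∈-pairs f g (there i) with ∈-pairs f g i
... | a , b = there (there a) , there (there b)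

allAssignments-complete : {n : ℕ} (S : Vec Bool n) → ∃ λ x → (x ∈ allAssignments n) × (∀ i → x i ≡ lookup S i)
allAssignments-complete []      = _ , here refl , λ ()
allAssignments-complete (s ∷ S) with allAssignments-complete S
allAssignments-complete (true ∷ S)  | x , x∈ , h = _ , proj₁ (∈-pairs _ _ x∈) , λ { zero → refl ; (suc i) → h i }
allAssignments-complete (false ∷ S) | x , x∈ , h = _ , proj₂ (∈-pairs _ _ x∈) , λ { zero → refl ; (suc i) → h i }

max-≥ : {A : Set} (f : A → ℕ) {xs : List A} {x : A} → x ∈ xs → f x ≤ foldr _⊔_ 0 (map f xs)
max-≥ f (here refl) = m≤m⊔n _ _
max-≥ f {y ∷ xs} (there i) = ≤-trans (max-≥ f i) (m≤n⊔m (f y) _)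

max-attained : {A : Set} (f : A → ℕ) (xs : List A) → (foldr _⊔_ 0 (map f xs) ≡ 0) ⊎ (∃ λ x → f x ≡ foldr _⊔_ 0 (map f xs))
max-attained f []       = inj₁ refl
max-attained f (x ∷ xs) with ⊔-sel (f x) (foldr _⊔_ 0 (map f xs)) | max-attained f xs
... | inj₁ e | _            = inj₂ (x , sym e)
... | inj₂ e | inj₁ z       = inj₁ (trans e z)
... | inj₂ e | inj₂ (y , z) = inj₂ (y , trans z (sym e))

cutCount≤max : {n : ℕ} (E : List (Edge n)) (S : Vec Bool n) → cutCount (lookup S) E ≤ maxCutCount E
cutCount≤max E S with allAssignments-complete S
... | x , x∈ , h = ≤-trans (≤-reflexive (sym (cutCount-cong E h))) (max-≥ (λ x → cutCount x E) x∈)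

-- Independent rounding: vertex i is put on the tail side with probability p i / Q.
round : {n : ℕ} (E : List (Edge n)) → NoLoops E → (p q : Fin n → ℕ) {Q : ℕ} .{{_ : NonZero Q}} → (∀ i → p i + q i ≡ Q) →
  ∑ E (λ e → p (proj₁ e) * q (proj₂ e)) ≤ Q * Q * maxCutCount E
round {n} E nl p q {Q} h with 𝔼-max {p = p} {q} h (λ S → cutCount (lookup S) E)
... | S , bound = *-cancelˡ-≤ (Q ^ n) {{m^n≢0 Q n}} (begin
  Q ^ n * ∑ E (λ e → p (proj₁ e) * q (proj₂ e))         ≡⟨ ∑-*ˡ E (Q ^ n) ⟨
  ∑ E (λ e → Q ^ n * (p (proj₁ e) * q (proj₂ e)))       ≡⟨ ∑-cong-∈ E (λ {e} e∈ → sym (𝔼-cut {p = p} {q} h (proj₁ e) (proj₂ e) (All.lookup nl e∈))) ⟩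
  ∑ E (λ e → Q * (Q * 𝔼 p q (cutE e)))                  ≡⟨ trans (∑-*ˡ E Q) (cong (Q *_) (∑-*ˡ E Q)) ⟩
  Q * (Q * ∑ E (λ e → 𝔼 p q (cutE e)))                  ≡⟨ cong (λ z → Q * (Q * z)) (𝔼-∑ {p = p} {q} h E {cutE}) ⟨
  Q * (Q * 𝔼 p q (λ S → ∑ E (λ e → cutE e S)))          ≡⟨ cong (λ z → Q * (Q * z)) (𝔼-cong {p = p} {q} (λ S → sym (cutCount≡∑ (lookup S) E))) ⟩
  Q * (Q * 𝔼 p q (λ S → cutCount (lookup S) E))         ≤⟨ *-monoʳ-≤ Q (*-monoʳ-≤ Q bound) ⟩
  Q * (Q * (Q ^ n * cutCount (lookup S) E))             ≤⟨ *-monoʳ-≤ Q (*-monoʳ-≤ Q (*-monoʳ-≤ (Q ^ n) (cutCount≤max E S))) ⟩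
  Q * (Q * (Q ^ n * maxCutCount E))                     ≡⟨ lem Q (Q ^ n) (maxCutCount E) ⟩
  Q ^ n * (Q * Q * maxCutCount E)                       ∎)
  where
  open ≤-Reasoning
  cutE : Edge n → Vec Bool n → ℕ
  cutE e S = cut (lookup S (proj₁ e)) (lookup S (proj₂ e))
  lem : ∀ Q x m → Q * (Q * (x * m)) ≡ x * (Q * Q * m)
  lem = solve-∀

-- A fair coin at each vertex cuts a quarter of the edges on average. This later turns errors of
-- order |E| into relative ones.
length≤4*max : {n : ℕ} (E : List (Edge n)) → NoLoops E → length E ≤ 4 * maxCutCount E
length≤4*max E nl = begin
  length E        ≡⟨ *-identityʳ (length E) ⟨
  length E * 1    ≡⟨ ∑-const E 1 ⟨
  ∑ E (λ _ → 1)   ≤⟨ round E nl (λ _ → 1) (λ _ → 1) (λ _ → refl) ⟩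
  4 * maxCutCount E ∎
  where open ≤-Reasoning

-- Projected subgradient ascent on the relaxation.

dist² : ∀ a b → ∣ a - b ∣ * ∣ a - b ∣ + 2 * (a * b) ≡ a * a + b * b
dist² a b with ≤-total a b
... | inj₁ a≤b rewrite m≤n⇒∣m-n∣≡n∸m a≤b = subst (λ b → (b ∸ a) * (b ∸ a) + 2 * (a * b) ≡ a * a + b * b) (m+[n∸m]≡n a≤b) (go a (b ∸ a))
  where
  go : ∀ a c → (a + c ∸ a) * (a + c ∸ a) + 2 * (a * (a + c)) ≡ a * a + (a + c) * (a + c)
  go a c rewrite m+n∸m≡n a c = lem a c
    where
    lem : ∀ a c → c * c + 2 * (a * (a + c)) ≡ a * a + (a + c) * (a + c)
    lem = solve-∀
... | inj₂ b≤a rewrite m≤n⇒∣n-m∣≡n∸m b≤a = subst (λ a → (a ∸ b) * (a ∸ b) + 2 * (a * b) ≡ a * a + b * b) (m+[n∸m]≡n b≤a) (go b (a ∸ b))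
  where
  go : ∀ b c → (b + c ∸ b) * (b + c ∸ b) + 2 * ((b + c) * b) ≡ (b + c) * (b + c) + b * b
  go b c rewrite m+n∸m≡n b c = lem b c
    where
    lem : ∀ b c → c * c + 2 * ((b + c) * b) ≡ (b + c) * (b + c) + b * b
    lem = solve-∀

am-gm : ∀ a b → 2 * (a * b) ≤ a * a + b * b
am-gm a b = ≤-trans (m≤n+m _ (∣ a - b ∣ * ∣ a - b ∣)) (≤-reflexive (dist² a b))

-- Nonexpansiveness of the projection onto [0, K]: truncated subtraction projects at 0 and `⊓ K` at
-- K. On the right `i` is moved over to `y`, since a - i may be negative.
clip-contracts : ∀ a i K y → y ≤ K → ∣ (a ∸ i) ⊓ K - y ∣ ≤ ∣ a - (i + y) ∣
clip-contracts a i K y y≤K = ≤-trans (cap (a ∸ i)) floor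
  where
  open ≤-Reasoning
  cap : ∀ z → ∣ z ⊓ K - y ∣ ≤ ∣ z - y ∣
  cap z with ≤-total z K
  ... | inj₁ z≤K rewrite m≤n⇒m⊓n≡m z≤K = ≤-refl
  ... | inj₂ K≤z rewrite m≥n⇒m⊓n≡n K≤z | m≤n⇒∣n-m∣≡n∸m y≤K | m≤n⇒∣n-m∣≡n∸m (≤-trans y≤K K≤z) = ∸-monoˡ-≤ y K≤z
  floor : ∣ a ∸ i - y ∣ ≤ ∣ a - (i + y) ∣
  floor with ≤-total i a
  ... | inj₁ i≤a = begin
    ∣ a ∸ i - y ∣             ≡⟨ ∣m+n-m+o∣≡∣n-o∣ i (a ∸ i) y ⟨
    ∣ i + (a ∸ i) - i + y ∣   ≡⟨ cong (λ z → ∣ z - i + y ∣) (m+[n∸m]≡n i≤a) ⟩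
    ∣ a - (i + y) ∣           ∎
  ... | inj₂ a≤i rewrite m≤n⇒m∸n≡0 a≤i | m≤n⇒∣m-n∣≡n∸m (≤-trans a≤i (m≤m+n i y)) = begin
    y           ≡⟨ m+n∸m≡n i y ⟨
    i + y ∸ i   ≤⟨ ∸-monoʳ-≤ (i + y) a≤i ⟩
    i + y ∸ a   ∎

-- One coordinate of a projected subgradient step from x with subgradient o − i,
-- measured against y; all terms are moved so that no subtraction occurs.
step-progress : ∀ x o i K y d → y ≤ K → o + i ≤ d →
  ∣ ((x + o) ∸ i) ⊓ K - y ∣ * ∣ ((x + o) ∸ i) ⊓ K - y ∣ + 2 * (o * y + i * x)
    ≤ ∣ x - y ∣ * ∣ x - y ∣ + 2 * (o * x + i * y) + d * d
step-progress x o i K y d y≤K o+i≤d = begin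
  A * A + 2 * (o * y + i * x)  ≤⟨ +-monoˡ-≤ _ (*-mono-≤ contracts contracts) ⟩
  B * B + 2 * (o * y + i * x)  ≤⟨ +-cancelʳ-≤ (2 * ((x + o) * (i + y)) + 2 * (x * y)) _ _ balance ⟩
  C * C + 2 * (o * x + i * y) + d * d ∎
  where
  open ≤-Reasoning
  A = ∣ ((x + o) ∸ i) ⊓ K - y ∣
  B = ∣ x + o - (i + y) ∣
  C = ∣ x - y ∣
  contracts : A ≤ B
  contracts = clip-contracts (x + o) i K y y≤K
  shuffleˡ : ∀ b u v w → b + u + (v + w) ≡ b + v + (u + w)
  shuffleˡ = solve-∀
  shuffleʳ : ∀ c u d v w → c + u + d + (v + w) ≡ c + w + (u + d + v)
  shuffleʳ = solve-∀
  expand : ∀ x o i y →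
    (x + o) * (x + o) + (i + y) * (i + y) + (2 * (o * y + i * x) + 2 * (x * y)) + 4 * (o * i)
      ≡ x * x + y * y + (2 * (o * x + i * y) + (o + i) * (o + i) + 2 * ((x + o) * (i + y)))
  expand = solve-∀
  balance : B * B + 2 * (o * y + i * x) + (2 * ((x + o) * (i + y)) + 2 * (x * y))
    ≤ C * C + 2 * (o * x + i * y) + d * d + (2 * ((x + o) * (i + y)) + 2 * (x * y))
  balance = begin
    B * B + 2 * (o * y + i * x) + (2 * ((x + o) * (i + y)) + 2 * (x * y))
      ≡⟨ shuffleˡ (B * B) (2 * (o * y + i * x)) (2 * ((x + o) * (i + y))) (2 * (x * y)) ⟩
    B * B + 2 * ((x + o) * (i + y)) + (2 * (o * y + i * x) + 2 * (x * y))
      ≡⟨ cong (_+ (2 * (o * y + i * x) + 2 * (x * y))) (dist² (x + o) (i + y)) ⟩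
    (x + o) * (x + o) + (i + y) * (i + y) + (2 * (o * y + i * x) + 2 * (x * y))
      ≤⟨ m≤m+n _ (4 * (o * i)) ⟩
    (x + o) * (x + o) + (i + y) * (i + y) + (2 * (o * y + i * x) + 2 * (x * y)) + 4 * (o * i)
      ≡⟨ expand x o i y ⟩
    x * x + y * y + (2 * (o * x + i * y) + (o + i) * (o + i) + 2 * ((x + o) * (i + y)))
      ≤⟨ +-monoʳ-≤ (x * x + y * y) (+-monoˡ-≤ _ (+-monoʳ-≤ (2 * (o * x + i * y)) (*-mono-≤ o+i≤d o+i≤d))) ⟩
    x * x + y * y + (2 * (o * x + i * y) + d * d + 2 * ((x + o) * (i + y)))
      ≡⟨ cong (_+ (2 * (o * x + i * y) + d * d + 2 * ((x + o) * (i + y)))) (dist² x y) ⟨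
    C * C + 2 * (x * y) + (2 * (o * x + i * y) + d * d + 2 * ((x + o) * (i + y)))
      ≡⟨ shuffleʳ (C * C) (2 * (o * x + i * y)) (d * d) (2 * ((x + o) * (i + y))) (2 * (x * y)) ⟨
    C * C + 2 * (o * x + i * y) + d * d + (2 * ((x + o) * (i + y)) + 2 * (x * y)) ∎

module Ascent {n : ℕ} (K : ℕ) where

  -- With x scaled to [0,1], gain is the concave relaxation min(x u, 1 − x v) of the cut indicator; its
  -- subgradient moves x u up on a low edge and x v down on a high edge.
  low high gain : (Fin n → ℕ) → Edge n → ℕ
  low  x (u , v) = ⟦ ⌊ x u + x v ≤? K ⌋ ⟧
  high x (u , v) = ⟦ not ⌊ x u + x v ≤? K ⌋ ⟧
  gain x (u , v) = x u ⊓ (K ∸ x v)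

  up down : List (Edge n) → (Fin n → ℕ) → Fin n → ℕ
  up   E x v = ∑ E (ends (low x) (λ _ → 0) v)
  down E x v = ∑ E (ends (λ _ → 0) (high x) v)

  iterate : List (Edge n) → ℕ → Fin n → ℕ
  iterate E zero    v = 0
  iterate E (suc t) v = ((iterate E t v + up E (iterate E t) v) ∸ down E (iterate E t) v) ⊓ K

  φ : List (Edge n) → ℕ → Edge n → ℕ
  φ E zero    e = 0
  φ E (suc T) e = φ E T e + gain (iterate E T) e

  iterate≤K : ∀ E t v → iterate E t v ≤ K
  iterate≤K E zero    v = z≤n
  iterate≤K E (suc t) v = m⊓n≤n _ K

  φ≤ : ∀ E T e → φ E T e ≤ T * K
  φ≤ E zero    e = z≤n
  φ≤ E (suc T) e@(u , v) = ≤-trans (+-mono-≤ (φ≤ E T e) (≤-trans (m⊓n≤m _ _) (iterate≤K E T u))) (≤-reflexive (+-comm (T * K) K))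

  low+high : ∀ x e → low x e + high x e ≡ 1
  low+high x (u , v) with x u + x v ≤? K
  ... | yes _ = refl
  ... | no _  = refl

  up+down≤deg : ∀ E x v → up E x v + down E x v ≤ deg E v
  up+down≤deg E x v = ≤-trans (≤-reflexive (sym (∑-+ E))) (∑-mono E per-edge)
    where
    shuffle : ∀ a b l h → (a * l + b * 0) + (a * 0 + b * h) ≡ a * l + b * h
    shuffle = solve-∀
    per-edge : ∀ e → ends (low x) (λ _ → 0) v e + ends (λ _ → 0) (high x) v e ≤ ends (λ _ → 1) (λ _ → 1) v e
    per-edge e@(a , b) = ≤-trans (≤-reflexive (shuffle (δ a v) (δ b v) (low x e) (high x e)))
      (+-mono-≤ (*-monoʳ-≤ (δ a v) (m+n≤o⇒m≤o (low x e) (≤-reflexive (low+high x e))))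
                (*-monoʳ-≤ (δ b v) (m+n≤o⇒n≤o (low x e) (≤-reflexive (low+high x e)))))

  -- Concavity with the terms rearranged. On a low edge `gain x` is x u while `gain y` is at most y
  -- u; on a high edge `gain x` is K - x v while `gain y` is at most K - y v.
  gain-subgradient : ∀ x y e → (∀ v → x v ≤ K) → (∀ v → y v ≤ K) →
    (low x e * x (proj₁ e) + high x e * y (proj₂ e)) + gain y e
      ≤ (low x e * y (proj₁ e) + high x e * x (proj₂ e)) + gain x e
  gain-subgradient x y (u , v) x≤K y≤K with x u + x v ≤? K
  ... | yes lo = begin
    1 * x u + 0 + y u ⊓ (K ∸ y v)   ≤⟨ +-monoʳ-≤ (1 * x u + 0) (m⊓n≤m (y u) _) ⟩
    1 * x u + 0 + y u               ≡⟨ swap (x u) (y u) ⟩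
    1 * y u + 0 + x u               ≡⟨ cong (1 * y u + 0 +_) (m≤n⇒m⊓n≡m (m+n≤o⇒m≤o∸n (x u) lo)) ⟨
    1 * y u + 0 + x u ⊓ (K ∸ x v)   ∎
    where
    open ≤-Reasoning
    swap : ∀ a b → 1 * a + 0 + b ≡ 1 * b + 0 + a
    swap = solve-∀
  ... | no hi = begin
    1 * y v + y u ⊓ (K ∸ y v)   ≤⟨ +-mono-≤ (≤-reflexive (*-identityˡ (y v))) (m⊓n≤n (y u) _) ⟩
    y v + (K ∸ y v)             ≡⟨ m+[n∸m]≡n (y≤K v) ⟩
    K                           ≡⟨ m+[n∸m]≡n (x≤K v) ⟨
    x v + (K ∸ x v)             ≡⟨ cong₂ _+_ (*-identityˡ (x v)) (m≥n⇒m⊓n≡n (≤-trans (∸-monoˡ-≤ (x v) (<⇒≤ (≰⇒> hi))) (≤-reflexive (m+n∸n≡m (x u) (x v))))) ⟨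
    1 * x v + x u ⊓ (K ∸ x v)   ∎
    where open ≤-Reasoning

  module _ (E : List (Edge n)) (y : Fin n → ℕ) (y≤K : ∀ v → y v ≤ K) where

    sq : ℕ → Fin n → ℕ
    sq t v = ∣ iterate E t v - y v ∣ * ∣ iterate E t v - y v ∣

    deg² : ℕ
    deg² = ∑ᵛ (λ v → deg E v * deg E v)

    -- `step-progress` summed over the vertices leaves the linear terms `L` and `R`. Double counting
    -- turns these into edge sums, and the subgradient inequality R + Y ≤ L + G trades them for the
    -- gains.
    descent : ∀ t → ∑ᵛ (sq (suc t)) + 2 * ∑ E (gain y) ≤ ∑ᵛ (sq t) + 2 * ∑ E (gain (iterate E t)) + deg²
    descent t = +-cancelʳ-≤ (2 * L + 2 * R) _ _ (begin
      sq′ + 2 * Y + (2 * L + 2 * R)               ≡⟨ shuffle₁ sq′ Y L R ⟩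
      sq′ + 2 * L + 2 * (R + Y)                   ≤⟨ +-mono-≤ vertices (*-monoʳ-≤ 2 edges) ⟩
      sq₀ + 2 * R + deg² + 2 * (L + G)            ≡⟨ shuffle₂ sq₀ R deg² L G ⟩
      sq₀ + 2 * G + deg² + (2 * L + 2 * R)        ∎)
      where
      open ≤-Reasoning
      x = iterate E t
      sq′ = ∑ᵛ (sq (suc t))
      sq₀ = ∑ᵛ (sq t)
      Y = ∑ E (gain y)
      G = ∑ E (gain x)
      L = ∑ᵛ (λ v → up E x v * y v + down E x v * x v)
      R = ∑ᵛ (λ v → up E x v * x v + down E x v * y v)
      shuffle₁ : ∀ s y l r → s + 2 * y + (2 * l + 2 * r) ≡ s + 2 * l + 2 * (r + y)
      shuffle₁ = solve-∀
      shuffle₂ : ∀ s r d l g → s + 2 * r + d + 2 * (l + g) ≡ s + 2 * g + d + (2 * l + 2 * r)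
      shuffle₂ = solve-∀
      exchange : ∀ (a b : Fin n → ℕ) → ∑ᵛ (λ v → up E x v * a v + down E x v * b v) ≡ ∑ E (λ e → low x e * a (proj₁ e) + high x e * b (proj₂ e))
      exchange a b = begin-equality
        ∑ᵛ (λ v → up E x v * a v + down E x v * b v)                ≡⟨ ∑-+ (allFin n) ⟩
        ∑ᵛ (λ v → up E x v * a v) + ∑ᵛ (λ v → down E x v * b v)     ≡⟨ cong₂ _+_ (∑ᵛ-ends E (low x) (λ _ → 0) a) (∑ᵛ-ends E (λ _ → 0) (high x) b) ⟩
        ∑ E (λ e → low x e * a (proj₁ e) + 0) + ∑ E (λ e → high x e * b (proj₂ e)) ≡⟨ ∑-+ E ⟨
        ∑ E (λ e → low x e * a (proj₁ e) + 0 + high x e * b (proj₂ e))  ≡⟨ ∑-cong E (λ e → cong (_+ high x e * b (proj₂ e)) (+-identityʳ _)) ⟩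
        ∑ E (λ e → low x e * a (proj₁ e) + high x e * b (proj₂ e))  ∎
      edges : R + Y ≤ L + G
      edges = begin
        R + Y ≡⟨ cong (_+ Y) (exchange x y) ⟩
        ∑ E (λ e → low x e * x (proj₁ e) + high x e * y (proj₂ e)) + Y ≡⟨ ∑-+ E ⟨
        ∑ E (λ e → low x e * x (proj₁ e) + high x e * y (proj₂ e) + gain y e)
          ≤⟨ ∑-mono E (λ e → gain-subgradient x y e (iterate≤K E t) y≤K) ⟩
        ∑ E (λ e → low x e * y (proj₁ e) + high x e * x (proj₂ e) + gain x e) ≡⟨ ∑-+ E ⟩
        ∑ E (λ e → low x e * y (proj₁ e) + high x e * x (proj₂ e)) + G ≡⟨ cong (_+ G) (exchange y x) ⟨
        L + G ∎
      vertices : sq′ + 2 * L ≤ sq₀ + 2 * R + deg²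
      vertices = begin
        sq′ + 2 * L ≡⟨ cong (sq′ +_) (∑-*ˡ (allFin n) 2) ⟨
        sq′ + ∑ᵛ (λ v → 2 * (up E x v * y v + down E x v * x v)) ≡⟨ ∑-+ (allFin n) ⟨
        ∑ᵛ (λ v → sq (suc t) v + 2 * (up E x v * y v + down E x v * x v))
          ≤⟨ ∑-mono (allFin n) (λ v → step-progress (x v) (up E x v) (down E x v) K (y v) (deg E v) (y≤K v) (up+down≤deg E x v)) ⟩
        ∑ᵛ (λ v → sq t v + 2 * (up E x v * x v + down E x v * y v) + deg E v * deg E v) ≡⟨ ∑-+ (allFin n) ⟩
        ∑ᵛ (λ v → sq t v + 2 * (up E x v * x v + down E x v * y v)) + deg² ≡⟨ cong (_+ deg²) (∑-+ (allFin n)) ⟩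
        sq₀ + ∑ᵛ (λ v → 2 * (up E x v * x v + down E x v * y v)) + deg² ≡⟨ cong (λ z → sq₀ + z + deg²) (∑-*ˡ (allFin n) 2) ⟩
        sq₀ + 2 * R + deg² ∎

    telescope : ∀ T → ∑ᵛ (sq T) + T * (2 * ∑ E (gain y)) ≤ ∑ᵛ (sq 0) + 2 * ∑ E (φ E T) + T * deg²
    telescope zero = ≤-trans (≤-reflexive (+-identityʳ _)) (≤-trans (m≤m+n _ _) (m≤m+n _ _))
    telescope (suc T) = +-cancelʳ-≤ (∑ᵛ (sq T)) _ _ (begin
      s′ + (y2 + T * y2) + s                            ≡⟨ shuffle₁ s′ y2 (T * y2) s ⟩
      (s′ + y2) + (s + T * y2)                          ≤⟨ +-mono-≤ (descent T) (telescope T) ⟩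
      (s + 2 * g + deg²) + (s₀ + 2 * f + T * deg²)      ≡⟨ shuffle₂ s g deg² s₀ f (T * deg²) ⟩
      s₀ + 2 * (f + g) + (deg² + T * deg²) + s          ≡⟨ cong (λ z → s₀ + 2 * z + (deg² + T * deg²) + s) (∑-+ E) ⟨
      s₀ + 2 * ∑ E (φ E (suc T)) + (deg² + T * deg²) + s ∎)
      where
      open ≤-Reasoning
      s′ = ∑ᵛ (sq (suc T))
      s = ∑ᵛ (sq T)
      s₀ = ∑ᵛ (sq 0)
      y2 = 2 * ∑ E (gain y)
      g = ∑ E (gain (iterate E T))
      f = ∑ E (φ E T)
      shuffle₁ : ∀ a b c d → a + (b + c) + d ≡ (a + b) + (d + c)
      shuffle₁ = solve-∀
      shuffle₂ : ∀ s g d a f e → (s + 2 * g + d) + (a + 2 * f + e) ≡ a + 2 * (f + g) + (d + e) + s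
      shuffle₂ = solve-∀

    isolated-fixed : ∀ t v → deg E v ≡ 0 → iterate E t v ≡ 0
    isolated-fixed zero    v d0 = refl
    isolated-fixed (suc t) v d0
      rewrite isolated-fixed t v d0
            | n≤0⇒n≡0 (≤-trans (m+n≤o⇒m≤o (up E (iterate E t) v) (up+down≤deg E (iterate E t) v)) (≤-reflexive d0))
      = n≤0⇒n≡0 (≤-trans (m⊓n≤m _ K) (≤-reflexive (0∸n≡0 (down E (iterate E t) v))))

    -- At an isolated vertex both distances are equal, the iterate being 0 throughout; elsewhere the
    -- degree is at least 1 and the left side is at most K².
    sq₀≤ : ∀ T v → sq 0 v ≤ sq T v + deg E v * (K * K)
    sq₀≤ T v with deg E v in eq
    ... | zero rewrite isolated-fixed T v eq = m≤m+n _ 0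
    ... | suc d = ≤-trans (*-mono-≤ (y≤K v) (y≤K v)) (≤-trans (m≤m+n _ (d * (K * K))) (m≤n+m _ (sq T v)))

    regret : ∀ {D} T → (∀ v → deg E v ≤ D) → T * ∑ E (gain y) ≤ ∑ E (φ E T) + length E * (K * K + T * D)
    regret {D} T dg = *-cancelˡ-≤ 2 (+-cancelˡ-≤ s _ _ (begin
      s + 2 * (T * Y)                                ≡⟨ cong (s +_) (swap T Y) ⟩
      s + T * (2 * Y)                                ≤⟨ telescope T ⟩
      ∑ᵛ (sq 0) + 2 * F + T * deg²                   ≤⟨ +-mono-≤ (+-monoˡ-≤ (2 * F) initial) (*-monoʳ-≤ T squares) ⟩
      s + m * 2 * (K * K) + 2 * F + T * (m * 2 * D)  ≡⟨ shuffle s m (K * K) F T D ⟩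
      s + 2 * (F + m * (K * K + T * D))              ∎))
      where
      open ≤-Reasoning
      s = ∑ᵛ (sq T)
      Y = ∑ E (gain y)
      F = ∑ E (φ E T)
      m = length E
      swap : ∀ t y → 2 * (t * y) ≡ t * (2 * y)
      swap = solve-∀
      shuffle : ∀ s m k f t d → s + m * 2 * k + 2 * f + t * (m * 2 * d) ≡ s + 2 * (f + m * (k + t * d))
      shuffle = solve-∀
      initial : ∑ᵛ (sq 0) ≤ s + m * 2 * (K * K)
      initial = begin
        ∑ᵛ (sq 0)                                ≤⟨ ∑-mono (allFin n) (sq₀≤ T) ⟩
        ∑ᵛ (λ v → sq T v + deg E v * (K * K))    ≡⟨ ∑-+ (allFin n) ⟩
        s + ∑ᵛ (λ v → deg E v * (K * K))         ≡⟨ cong (s +_) (∑-*ʳ (allFin n) (K * K)) ⟩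
        s + ∑ᵛ (deg E) * (K * K)                 ≡⟨ cong (λ z → s + z * (K * K)) (∑ᵛ-deg-total E) ⟩
        s + m * 2 * (K * K)                      ∎
      squares : deg² ≤ m * 2 * D
      squares = begin
        deg²                       ≤⟨ ∑-mono (allFin n) (λ v → *-monoʳ-≤ (deg E v) (dg v)) ⟩
        ∑ᵛ (λ v → deg E v * D)     ≡⟨ ∑-*ʳ (allFin n) D ⟩
        ∑ᵛ (deg E) * D             ≡⟨ cong (_* D) (∑ᵛ-deg-total E) ⟩
        m * 2 * D                  ∎

  -- Each iterate is rounded on its own, with tail probability (K + 2 x v) / (4 K), so nothing here
  -- depends on how far the ascent has converged.
  φ-upper : ∀ E → NoLoops E → .{{_ : NonZero K}} → ∀ T → ∑ E (φ E T) ≤ T * (2 * K * maxCutCount E)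
  φ-upper E nl zero    = ≤-reflexive (∑-0 E)
  φ-upper E nl (suc T) = begin
    ∑ E (φ E (suc T))            ≡⟨ ∑-+ E ⟩
    ∑ E (φ E T) + ∑ E (gain x)   ≤⟨ +-mono-≤ (φ-upper E nl T) rounded ⟩
    T * (2 * K * M) + 2 * K * M  ≡⟨ +-comm (T * (2 * K * M)) _ ⟩
    2 * K * M + T * (2 * K * M)  ∎
    where
    open ≤-Reasoning
    x = iterate E T
    M = maxCutCount E
    q : Fin n → ℕ
    q v = K + 2 * (K ∸ x v)
    sum-to-4K : ∀ v → K + 2 * x v + q v ≡ 4 * K
    sum-to-4K v = trans (lem K (x v) (K ∸ x v)) (trans (cong (λ z → 2 * K + 2 * z) (m+[n∸m]≡n (iterate≤K E T v))) (lem′ K))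
      where
      lem : ∀ k a b → k + 2 * a + (k + 2 * b) ≡ 2 * k + 2 * (a + b)
      lem = solve-∀
      lem′ : ∀ k → 2 * k + 2 * k ≡ 4 * k
      lem′ = solve-∀
    -- AM-GM: 8 K z ≤ (K + 2 z)²
    half : ∀ e → 8 * K * gain x e ≤ (K + 2 * x (proj₁ e)) * q (proj₂ e)
    half e@(u , v) = begin
      8 * K * z                            ≡⟨ lem K z ⟩
      2 * (K * (2 * z)) + 2 * (K * (2 * z)) ≤⟨ +-monoˡ-≤ _ (am-gm K (2 * z)) ⟩
      K * K + 2 * z * (2 * z) + 2 * (K * (2 * z)) ≡⟨ lem′ K z ⟩
      (K + 2 * z) * (K + 2 * z)            ≤⟨ *-mono-≤ (+-monoʳ-≤ K (*-monoʳ-≤ 2 (m⊓n≤m (x u) _))) (+-monoʳ-≤ K (*-monoʳ-≤ 2 (m⊓n≤n (x u) _))) ⟩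
      (K + 2 * x u) * q v                  ∎
      where
      z = gain x e
      lem : ∀ k z → 8 * k * z ≡ 2 * (k * (2 * z)) + 2 * (k * (2 * z))
      lem = solve-∀
      lem′ : ∀ k z → k * k + 2 * z * (2 * z) + 2 * (k * (2 * z)) ≡ (k + 2 * z) * (k + 2 * z)
      lem′ = solve-∀
    rounded : ∑ E (gain x) ≤ 2 * K * M
    rounded = *-cancelˡ-≤ (8 * K) {{m*n≢0 8 K}} (begin
      8 * K * ∑ E (gain x)          ≡⟨ ∑-*ˡ E (8 * K) ⟨
      ∑ E (λ e → 8 * K * gain x e)  ≤⟨ ∑-mono E half ⟩
      ∑ E (λ e → (K + 2 * x (proj₁ e)) * q (proj₂ e)) ≤⟨ round E nl (λ v → K + 2 * x v) q {{m*n≢0 4 K}} sum-to-4K ⟩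
      4 * K * (4 * K) * M           ≡⟨ lem K M ⟩
      8 * K * (2 * K * M)           ∎)
      where
      lem : ∀ k m → 4 * k * (4 * k) * m ≡ 8 * k * (2 * k * m)
      lem = solve-∀

  -- The indicator of an optimal cut, scaled by K, has relaxed value exactly K times the cut, so it
  -- can be the comparison point of `regret`.
  φ-lower : ∀ {D} E → (∀ v → deg E v ≤ D) → ∀ T → T * (K * maxCutCount E) ≤ ∑ E (φ E T) + length E * (K * K + T * D)
  φ-lower E dg T with max-attained (λ x → cutCount x E) (allAssignments n)
  -- The case where the maximum is 0, the initial value of the fold: the left-hand side vanishes.
  ... | inj₁ z rewrite z | *-zeroʳ K | *-zeroʳ T = z≤n
  ... | inj₂ (c , eq) = ≤-trans (≤-reflexive (cong (T *_) (sym cut-value))) (regret E y y≤K T dg)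
    where
    y : Fin n → ℕ
    y v = K * ⟦ c v ⟧
    y≤K : ∀ v → y v ≤ K
    y≤K v with c v
    ... | true  = ≤-reflexive (*-identityʳ K)
    ... | false = ≤-trans (≤-reflexive (*-zeroʳ K)) z≤n
    per-edge : ∀ e → gain y e ≡ K * cut (c (proj₁ e)) (c (proj₂ e))
    per-edge (u , v) with c u | c v
    ... | true  | true  rewrite *-identityʳ K | n∸n≡0 K = trans (⊓-zeroʳ K) (sym (*-zeroʳ K))
    ... | true  | false rewrite *-identityʳ K | *-zeroʳ K = ⊓-idem K
    ... | false | _     rewrite *-zeroʳ K = refl
    cut-value : ∑ E (gain y) ≡ K * maxCutCount E
    cut-value = trans (∑-cong E per-edge) (trans (∑-*ˡ E K) (cong (K *_) (trans (sym (cutCount≡∑ c E)) eq)))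

-- Locality of the ascent: walk counts and balls.

ends-cong : {n : ℕ} {f f′ g g′ : Edge n → ℕ} {v : Fin n} (e : Edge n) →
  (proj₁ e ≡ v → f e ≡ f′ e) → (proj₂ e ≡ v → g e ≡ g′ e) → ends f g v e ≡ ends f′ g′ v e
ends-cong {v = v} (a , b) hf hg = cong₂ _+_ tail head
  where
  tail : δ a v * _ ≡ δ a v * _
  tail with a ≟ v
  ... | yes p = cong (_+ 0) (hf p)
  ... | no _  = refl
  head : δ b v * _ ≡ δ b v * _
  head with b ≟ v
  ... | yes p = cong (_+ 0) (hg p)
  ... | no _  = refl

δ-sym : {n : ℕ} (u v : Fin n) → δ u v ≡ δ v u
δ-sym u v with u ≟ v | v ≟ u
... | yes _ | yes _ = refl
... | no _  | no _  = refl
... | yes p | no q  = ⊥-elim (q (sym p))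
... | no p  | yes q = ⊥-elim (p (sym q))

-- The number of lazy walks with fewer than t steps from v to w. The edges at the vertices w in its support
-- determine iterate E t v, and counting with multiplicity makes both row and column sums easy to bound.
walks : {n : ℕ} → List (Edge n) → ℕ → Fin n → Fin n → ℕ
walks E zero    v w = 0
walks E (suc t) v w = δ v w + walks E t v w + ∑ E (ends (λ e → walks E t (proj₂ e) w) (λ e → walks E t (proj₁ e) w) v)

ball : {n : ℕ} → List (Edge n) → ℕ → Edge n → Fin n → ℕ
ball E t (u , v) w = walks E t u w + walks E t v w

ballSize : ℕ → ℕ → ℕ
ballSize D zero    = 0
ballSize D (suc t) = 1 + ballSize D t + D * ballSize D t

module _ {n D : ℕ} (E : List (Edge n)) (dg : ∀ v → deg E v ≤ D) where

  walks-from : ∀ t v → ∑ᵛ (walks E t v) ≤ ballSize D t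
  walks-from zero    v = ≤-reflexive (∑-0 (allFin n))
  walks-from (suc t) v = begin
    ∑ᵛ (walks E (suc t) v)                        ≡⟨ ∑-+ (allFin n) ⟩
    ∑ᵛ (λ w → δ v w + walks E t v w) + ∑ᵛ (λ w → ∑ E (nbr w)) ≡⟨ cong₂ _+_ (∑-+ (allFin n)) (∑-swap (allFin n) E) ⟩
    ∑ᵛ (δ v) + ∑ᵛ (walks E t v) + ∑ E (λ e → ∑ᵛ (λ w → nbr w e))
      ≤⟨ +-mono-≤ (+-mono-≤ (≤-reflexive (∑ᵛ-δ₁ v)) (walks-from t v)) (∑-mono E per-edge) ⟩
    1 + c + ∑ E (λ e → ends (λ _ → 1) (λ _ → 1) v e * c) ≡⟨ cong (1 + c +_) (∑-*ʳ E c) ⟩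
    1 + c + deg E v * c                           ≤⟨ +-monoʳ-≤ (1 + c) (*-monoˡ-≤ c (dg v)) ⟩
    1 + c + D * c                                 ∎
    where
    open ≤-Reasoning
    c = ballSize D t
    nbr : Fin n → Edge n → ℕ
    nbr w = ends (λ e → walks E t (proj₂ e) w) (λ e → walks E t (proj₁ e) w) v
    shuffle : ∀ x y c → x * c + y * c ≡ (x * 1 + y * 1) * c
    shuffle = solve-∀
    per-edge : ∀ e → ∑ᵛ (λ w → nbr w e) ≤ ends (λ _ → 1) (λ _ → 1) v e * c
    per-edge e@(a , b) = begin
      ∑ᵛ (λ w → nbr w e)  ≡⟨ ∑-+ (allFin n) ⟩
      ∑ᵛ (λ w → δ a v * walks E t b w) + ∑ᵛ (λ w → δ b v * walks E t a w)
        ≡⟨ cong₂ _+_ (∑-*ˡ (allFin n) (δ a v)) (∑-*ˡ (allFin n) (δ b v)) ⟩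
      δ a v * ∑ᵛ (walks E t b) + δ b v * ∑ᵛ (walks E t a)
        ≤⟨ +-mono-≤ (*-monoʳ-≤ (δ a v) (walks-from t b)) (*-monoʳ-≤ (δ b v) (walks-from t a)) ⟩
      δ a v * c + δ b v * c ≡⟨ shuffle (δ a v) (δ b v) c ⟩
      ends (λ _ → 1) (λ _ → 1) v e * c ∎

  ∑ᵛ-deg≤ : (y : Fin n → ℕ) → ∑ E (λ e → y (proj₁ e) + y (proj₂ e)) ≤ D * ∑ᵛ y
  ∑ᵛ-deg≤ y = begin
    ∑ E (λ e → y (proj₁ e) + y (proj₂ e))  ≡⟨ ∑ᵛ-deg E y ⟨
    ∑ᵛ (λ v → deg E v * y v)               ≤⟨ ∑-mono (allFin n) (λ v → *-monoˡ-≤ (y v) (dg v)) ⟩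
    ∑ᵛ (λ v → D * y v)                     ≡⟨ ∑-*ˡ (allFin n) D ⟩
    D * ∑ᵛ y                               ∎
    where open ≤-Reasoning

  -- The column sums. Each edge passes the walks of one endpoint to the other, so by the handshake
  -- bound a column grows by the same recursion as a row.
  walks-to : ∀ t w → ∑ᵛ (λ v → walks E t v w) ≤ ballSize D t
  walks-to zero    w = ≤-reflexive (∑-0 (allFin n))
  walks-to (suc t) w = begin
    ∑ᵛ (λ v → walks E (suc t) v w)  ≡⟨ trans (∑-+ (allFin n)) (cong (_+ ∑ᵛ nbr) (∑-+ (allFin n))) ⟩
    ∑ᵛ (λ v → δ v w) + ∑ᵛ y + ∑ᵛ nbr
      ≤⟨ +-mono-≤ (+-mono-≤ (≤-reflexive (trans (∑-cong (allFin n) (λ v → δ-sym v w)) (∑ᵛ-δ₁ w))) (walks-to t w)) neighbours ⟩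
    1 + c + D * c  ∎
    where
    open ≤-Reasoning
    c = ballSize D t
    y nbr : Fin n → ℕ
    y v = walks E t v w
    nbr v = ∑ E (ends (λ e → y (proj₂ e)) (λ e → y (proj₁ e)) v)
    shuffle : ∀ a b → a * 1 + b * 1 ≡ b + a
    shuffle = solve-∀
    neighbours : ∑ᵛ nbr ≤ D * c
    neighbours = begin
      ∑ᵛ nbr                          ≡⟨ ∑-cong (allFin n) (λ v → sym (*-identityʳ (nbr v))) ⟩
      ∑ᵛ (λ v → nbr v * 1)            ≡⟨ ∑ᵛ-ends E (λ e → y (proj₂ e)) (λ e → y (proj₁ e)) (λ _ → 1) ⟩
      ∑ E (λ e → y (proj₂ e) * 1 + y (proj₁ e) * 1) ≡⟨ ∑-cong E (λ e → shuffle (y (proj₂ e)) (y (proj₁ e))) ⟩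
      ∑ E (λ e → y (proj₁ e) + y (proj₂ e)) ≤⟨ ∑ᵛ-deg≤ y ⟩
      D * ∑ᵛ y                        ≤⟨ *-monoʳ-≤ D (walks-to t w) ⟩
      D * c                           ∎

  ball-size : ∀ t e → ∑ᵛ (ball E t e) ≤ 2 * ballSize D t
  ball-size t (u , v) = ≤-trans (≤-reflexive (∑-+ (allFin n)))
    (≤-trans (+-mono-≤ (walks-from t u) (walks-from t v)) (≤-reflexive (cong (ballSize D t +_) (sym (+-identityʳ _)))))

  -- Limits how many edges have a given vertex in their ball. Together with `ball-size` it leaves
  -- only a constant number of meeting balls per edge, which is what the variance needs.
  ball-cover : ∀ t w → ∑ E (λ e → ball E t e w) ≤ D * ballSize D t
  ball-cover t w = ≤-trans (∑ᵛ-deg≤ (λ v → walks E t v w)) (*-monoʳ-≤ D (walks-to t w))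

Inside : {n : ℕ} → Vec Bool n → (Fin n → ℕ) → Set
Inside S B = ∀ w → ¬ (B w ≡ 0) → lookup S w ≡ true

Inside-≤ : {n : ℕ} {S : Vec Bool n} {B C : Fin n → ℕ} → (∀ w → C w ≤ B w) → Inside S B → Inside S C
Inside-≤ le inB w c≢0 = inB w (λ b≡0 → c≢0 (n≤0⇒n≡0 (≤-trans (le w) (≤-reflexive b≡0))))

-- Quantifying over `f` and `g` says that both streams have the same multiset of edges at each
-- sampled vertex, without speaking of permutations and in the form in which walks and subgradients
-- use it.
Agree : {n : ℕ} → Vec Bool n → (E E′ : List (Edge n)) → Set
Agree S E E′ = ∀ v → lookup S v ≡ true → ∀ f g → ∑ E (ends f g v) ≡ ∑ E′ (ends f g v)

module _ {n : ℕ} (K : ℕ) where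
  open Ascent {n} K

  self∈walks : ∀ (E : List (Edge n)) t v → ¬ (walks E (suc t) v v ≡ 0)
  self∈walks E t v eq rewrite δ-refl v = 1+n≢0 eq

  walks-tail : ∀ E t {e} v → e ∈ E → proj₁ e ≡ v → ∀ w → walks E t (proj₂ e) w ≤ walks E (suc t) v w
  walks-tail E t {e} v e∈ refl w = begin
    x                               ≡⟨ *-identityˡ x ⟨
    1 * x                           ≡⟨ cong (_* x) (δ-refl v) ⟨
    δ v v * x                       ≤⟨ m≤m+n _ _ ⟩
    nbr e                           ≤⟨ ∑-∈ nbr e∈ ⟩
    ∑ E nbr                         ≤⟨ m≤n+m _ _ ⟩
    walks E (suc t) v w             ∎
    where
    open ≤-Reasoning
    x = walks E t (proj₂ e) w
    nbr : Edge n → ℕ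
    nbr = ends (λ e → walks E t (proj₂ e) w) (λ e → walks E t (proj₁ e) w) v

  walks-head : ∀ E t {e} v → e ∈ E → proj₂ e ≡ v → ∀ w → walks E t (proj₁ e) w ≤ walks E (suc t) v w
  walks-head E t {e} v e∈ refl w = begin
    x                               ≡⟨ *-identityˡ x ⟨
    1 * x                           ≡⟨ cong (_* x) (δ-refl v) ⟨
    δ v v * x                       ≤⟨ m≤n+m _ _ ⟩
    nbr e                           ≤⟨ ∑-∈ nbr e∈ ⟩
    ∑ E nbr                         ≤⟨ m≤n+m _ _ ⟩
    walks E (suc t) v w             ∎
    where
    open ≤-Reasoning
    x = walks E t (proj₁ e) w
    nbr : Edge n → ℕ
    nbr = ends (λ e → walks E t (proj₂ e) w) (λ e → walks E t (proj₁ e) w) v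

  walks-mono : ∀ (E : List (Edge n)) t v w → walks E t v w ≤ walks E (suc t) v w
  walks-mono E t v w = ≤-trans (m≤n+m _ (δ v w)) (m≤m+n _ _)

  low-cong : ∀ {x y : Fin n → ℕ} e → x (proj₁ e) ≡ y (proj₁ e) → x (proj₂ e) ≡ y (proj₂ e) → low x e ≡ low y e
  low-cong e p q = cong₂ (λ a b → ⟦ ⌊ a + b ≤? K ⌋ ⟧) p q

  high-cong : ∀ {x y : Fin n → ℕ} e → x (proj₁ e) ≡ y (proj₁ e) → x (proj₂ e) ≡ y (proj₂ e) → high x e ≡ high y e
  high-cong e p q = cong₂ (λ a b → ⟦ not ⌊ a + b ≤? K ⌋ ⟧) p q

  module _ {S : Vec Bool n} {E E′ : List (Edge n)} (agree : Agree S E E′) where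

    -- Induction on `t`. `Inside` puts `v` itself into S, so both streams have the same edges there;
    -- walks from a neighbour extend to walks from `v`, so the neighbour's smaller ball lies in S
    -- too. Walk counts are carried along because the sampled stream alone must also tell which
    -- balls lie in S.
    local : ∀ t v → Inside S (walks E t v) →
      (∀ w → walks E′ t v w ≡ walks E t v w) × (iterate E′ t v ≡ iterate E t v)
    local zero    v ins = (λ _ → refl) , refl
    local (suc t) v ins = same-walks , same-iterate
      where
      v∈S : lookup S v ≡ true
      v∈S = ins v (self∈walks E t v)
      at-v = local t v (Inside-≤ {S = S} (walks-mono E t v) ins)
      across-tail : ∀ {e} → e ∈ E → proj₁ e ≡ v → _
      across-tail {e} e∈ p = local t (proj₂ e) (Inside-≤ {S = S} (walks-tail E t v e∈ p) ins)
      across-head : ∀ {e} → e ∈ E → proj₂ e ≡ v → _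
      across-head {e} e∈ p = local t (proj₁ e) (Inside-≤ {S = S} (walks-head E t v e∈ p) ins)
      same : ∀ {f f′ g g′ : Edge n → ℕ} → (∀ {e} → e ∈ E → proj₁ e ≡ v → f′ e ≡ f e) →
        (∀ {e} → e ∈ E → proj₂ e ≡ v → g′ e ≡ g e) → ∑ E′ (ends f′ g′ v) ≡ ∑ E (ends f g v)
      same {f} {f′} {g} {g′} hf hg = trans (sym (agree v v∈S f′ g′))
        (∑-cong-∈ E (λ {e} e∈ → ends-cong {f = f′} {f} {g′} {g} e (hf e∈) (hg e∈)))
      same-walks : ∀ w → walks E′ (suc t) v w ≡ walks E (suc t) v w
      same-walks w = cong₂ _+_ (cong (δ v w +_) (proj₁ at-v w))
        (same (λ e∈ p → proj₁ (across-tail e∈ p) w) (λ e∈ p → proj₁ (across-head e∈ p) w))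
      same-tail : ∀ {e} → e ∈ E → proj₁ e ≡ v → low (iterate E′ t) e ≡ low (iterate E t) e
      same-tail {e} e∈ refl = low-cong {iterate E′ t} {iterate E t} e (proj₂ at-v) (proj₂ (across-tail e∈ refl))
      same-head : ∀ {e} → e ∈ E → proj₂ e ≡ v → high (iterate E′ t) e ≡ high (iterate E t) e
      same-head {e} e∈ refl = high-cong {iterate E′ t} {iterate E t} e (proj₂ (across-head e∈ refl)) (proj₂ at-v)
      same-iterate : iterate E′ (suc t) v ≡ iterate E (suc t) v
      same-iterate = cong (_⊓ K) (cong₂ _∸_
        (cong₂ _+_ (proj₂ at-v) (same same-tail (λ _ _ → refl)))
        (same (λ _ _ → refl) same-head))

    ball-local : ∀ t e → Inside S (ball E t e) → ∀ w → ball E′ t e w ≡ ball E t e w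
    ball-local t (u , v) ins w = cong₂ _+_
      (proj₁ (local t u (Inside-≤ {S = S} (λ w → m≤m+n _ _) ins)) w)
      (proj₁ (local t v (Inside-≤ {S = S} (λ w → m≤n+m _ (walks E t u w)) ins)) w)

    φ-local : ∀ t e → Inside S (ball E t e) → φ E′ t e ≡ φ E t e
    φ-local zero    e       ins = refl
    φ-local (suc t) (u , v) ins = cong₂ _+_ (φ-local t (u , v) ins′) (cong₂ (λ a b → a ⊓ (K ∸ b))
      (proj₂ (local t u (Inside-≤ {S = S} (λ w → m≤m+n _ _) ins′)))
      (proj₂ (local t v (Inside-≤ {S = S} (λ w → m≤n+m _ (walks E t u w)) ins′))))
      where
      ins′ : Inside S (ball E t (u , v))
      ins′ = Inside-≤ {S = S} (λ w → +-mono-≤ (walks-mono E t u w) (walks-mono E t v w)) ins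

-- Vertex sampling and reweighting.

touches : {n : ℕ} → Vec Bool n → Edge n → Bool
touches S (u , v) = lookup S u ∨ lookup S v

sample : {n : ℕ} → Vec Bool n → List (Edge n) → List (Edge n)
sample S = filter (λ e → T? (touches S e))

∨-introˡ : ∀ {a} b → a ≡ true → Bool.T (a ∨ b)
∨-introˡ b refl = _

∨-introʳ : ∀ a {b} → b ≡ true → Bool.T (a ∨ b)
∨-introʳ true  refl = _
∨-introʳ false refl = _

sample-agree : {n : ℕ} (S : Vec Bool n) (E : List (Edge n)) → Agree S (sample S E) E
sample-agree S E v v∈S f g = ∑-filter (λ e → T? (touches S e)) E untouched
  where
  untouched : ∀ e → ¬ Bool.T (touches S e) → ends f g v e ≡ 0
  untouched (a , b) nt = trans (ends-cong {f = f} {λ _ → 0} {g} {λ _ → 0} (a , b)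
    (λ { refl → ⊥-elim (nt (∨-introˡ _ v∈S)) }) (λ { refl → ⊥-elim (nt (∨-introʳ (lookup S a) v∈S)) })) zeros
    where
    zeros : δ a v * 0 + δ b v * 0 ≡ 0
    zeros = cong₂ _+_ (*-zeroʳ (δ a v)) (*-zeroʳ (δ b v))

length-sample : {n D : ℕ} (S : Vec Bool n) (E : List (Edge n)) → (∀ v → deg E v ≤ D) →
  length (sample S E) ≤ D * ∑ᵛ (λ v → ⟦ lookup S v ⟧)
length-sample {n} {D} S E dg = ≤-trans (go E) (∑ᵛ-deg≤ E dg (λ v → ⟦ lookup S v ⟧))
  where
  go : ∀ E → length (sample S E) ≤ ∑ E (λ e → ⟦ lookup S (proj₁ e) ⟧ + ⟦ lookup S (proj₂ e) ⟧)
  go [] = z≤n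
  go ((u , v) ∷ E) with lookup S u | lookup S v
  ... | true  | true  = s≤s (≤-trans (go E) (n≤1+n _))
  ... | true  | false = s≤s (go E)
  ... | false | true  = s≤s (go E)
  ... | false | false = go E

-- b^|supp B| if supp B ⊆ S, and 0 otherwise.
weight₁ : ℕ → ℕ → Bool → ℕ
weight₁ b zero    s     = 1
weight₁ b (suc _) true  = b
weight₁ b (suc _) false = 0

weight : {n : ℕ} → ℕ → (Fin n → ℕ) → Vec Bool n → ℕ
weight b B []      = 1
weight b B (s ∷ S) = weight₁ b (B zero) s * weight b (B ∘ suc) S

weight-cong : {n : ℕ} {b : ℕ} {B C : Fin n → ℕ} → (∀ w → B w ≡ C w) → ∀ S → weight b B S ≡ weight b C S
weight-cong h []      = refl
weight-cong {b = b} h (s ∷ S) = cong₂ (λ x y → weight₁ b x s * y) (h zero) (weight-cong (h ∘ suc) S)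

weight-inside : {n : ℕ} {b : ℕ} {B : Fin n → ℕ} (S : Vec Bool n) → ¬ (weight b B S ≡ 0) → Inside S B
weight-inside {b = b} {B} (s ∷ S) w≢0 zero b≢0 with B zero | s
... | zero  | _     = ⊥-elim (b≢0 refl)
... | suc _ | true  = refl
... | suc _ | false = ⊥-elim (w≢0 refl)
weight-inside {b = b} {B} (s ∷ S) w≢0 (suc i) b≢0 =
  weight-inside {b = b} S (λ z → w≢0 (trans (cong (weight₁ b (B zero) s *_) z) (*-zeroʳ (weight₁ b (B zero) s)))) i b≢0

meet₁ : ℕ → ℕ → ℕ → ℕ
meet₁ b (suc _) (suc _) = b
meet₁ b _       _       = 1

-- This is `b` to the number of vertices common to both supports, the mixed second moment of two
-- weights.
meet : {n : ℕ} → ℕ → (B C : Fin n → ℕ) → ℕ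
meet {zero}  b B C = 1
meet {suc n} b B C = meet₁ b (B zero) (C zero) * meet b (B ∘ suc) (C ∘ suc)

-- Unbiasedness: a coordinate in the support contributes the factor b + 1 with probability 1 / (b +
-- 1), hence mean 1.
𝔼-weight : ∀ n b (B : Fin n → ℕ) → 𝔼 (λ _ → 1) (λ _ → b) (weight (suc b) B) ≡ suc b ^ n
𝔼-weight zero    b B = refl
𝔼-weight (suc n) b B
  rewrite 𝔼-*ˡ {p = λ _ → 1} {λ _ → b} (weight₁ (suc b) (B zero) true) {weight (suc b) (B ∘ suc)}
        | 𝔼-*ˡ {p = λ _ → 1} {λ _ → b} (weight₁ (suc b) (B zero) false) {weight (suc b) (B ∘ suc)}
        | 𝔼-weight n b (B ∘ suc)
  with B zero
... | zero  = lem b (suc b ^ n)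
  where
  lem : ∀ b x → 1 * (1 * x) + b * (1 * x) ≡ x + b * x
  lem = solve-∀
... | suc _ = lem b (suc b ^ n)
  where
  lem : ∀ b x → 1 * (x + b * x) + b * 0 ≡ x + b * x
  lem = solve-∀

-- A coordinate in both supports contributes (b + 1)² with probability 1 / (b + 1), hence mean b +
-- 1; every other coordinate has mean 1.
𝔼-weight² : ∀ n b (B C : Fin n → ℕ) →
  𝔼 (λ _ → 1) (λ _ → b) (λ S → weight (suc b) B S * weight (suc b) C S) ≡ suc b ^ n * meet (suc b) B C
𝔼-weight² zero    b B C = refl
𝔼-weight² (suc n) b B C = begin
  1 * 𝔼 (λ _ → 1) (λ _ → b) (WW true) + b * 𝔼 (λ _ → 1) (λ _ → b) (WW false)
    ≡⟨ cong₂ (λ x y → 1 * x + b * y) (factor true) (factor false) ⟩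
  1 * (c true * X) + b * (c false * X)
    ≡⟨ coordinate (B zero) (C zero) ⟩
  suc b * suc b ^ n * (meet₁ (suc b) (B zero) (C zero) * meet (suc b) (B ∘ suc) (C ∘ suc)) ∎
  where
  open ≡-Reasoning
  O = meet (suc b) (B ∘ suc) (C ∘ suc)
  X = suc b ^ n * O
  c : Bool → ℕ
  c s = weight₁ (suc b) (B zero) s * weight₁ (suc b) (C zero) s
  WW : Bool → Vec Bool n → ℕ
  WW s S = weight (suc b) B (s ∷ S) * weight (suc b) C (s ∷ S)
  shuffle : ∀ x y u v → x * u * (y * v) ≡ x * y * (u * v)
  shuffle = solve-∀
  factor : ∀ s → 𝔼 (λ _ → 1) (λ _ → b) (WW s) ≡ c s * X
  factor s = begin
    𝔼 (λ _ → 1) (λ _ → b) (WW s) ≡⟨ 𝔼-cong {p = λ _ → 1} {λ _ → b} (λ S → shuffle (weight₁ (suc b) (B zero) s) (weight₁ (suc b) (C zero) s) (weight (suc b) (B ∘ suc) S) (weight (suc b) (C ∘ suc) S)) ⟩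
    𝔼 (λ _ → 1) (λ _ → b) (λ S → c s * (weight (suc b) (B ∘ suc) S * weight (suc b) (C ∘ suc) S)) ≡⟨ 𝔼-*ˡ {n} {p = λ _ → 1} {λ _ → b} (c s) ⟩
    c s * 𝔼 (λ _ → 1) (λ _ → b) (λ S → weight (suc b) (B ∘ suc) S * weight (suc b) (C ∘ suc) S) ≡⟨ cong (c s *_) (𝔼-weight² n b (B ∘ suc) (C ∘ suc)) ⟩
    c s * X ∎
  once : ∀ b y o → 1 * ((1 + b) * 1 * (y * o)) + b * 0 ≡ (1 + b) * y * (1 * o)
  once = solve-∀
  once′ : ∀ b y o → 1 * (1 * (1 + b) * (y * o)) + b * 0 ≡ (1 + b) * y * (1 * o)
  once′ = solve-∀
  never : ∀ b y o → 1 * (1 * 1 * (y * o)) + b * (1 * 1 * (y * o)) ≡ (1 + b) * y * (1 * o)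
  never = solve-∀
  twice : ∀ b y o → 1 * ((1 + b) * (1 + b) * (y * o)) + b * 0 ≡ (1 + b) * y * ((1 + b) * o)
  twice = solve-∀
  coordinate : ∀ x y → 1 * (weight₁ (suc b) x true * weight₁ (suc b) y true * X) + b * (weight₁ (suc b) x false * weight₁ (suc b) y false * X)
    ≡ suc b * suc b ^ n * (meet₁ (suc b) x y * O)
  coordinate zero    zero    = never b (suc b ^ n) O
  coordinate zero    (suc _) = once′ b (suc b ^ n) O
  coordinate (suc _) zero    = once b (suc b ^ n) O
  coordinate (suc _) (suc _) = twice b (suc b ^ n) O

abstract

  -- Sampling with probability 1 / suc b.
  𝔼ₛ : {n : ℕ} → ℕ → (Vec Bool n → ℕ) → ℕ
  𝔼ₛ b = 𝔼 (λ _ → 1) (λ _ → b)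

  𝔼ₛ-cong : ∀ {n b} {f g : Vec Bool n → ℕ} → (∀ S → f S ≡ g S) → 𝔼ₛ b f ≡ 𝔼ₛ b g
  𝔼ₛ-cong = 𝔼-cong

  𝔼ₛ-mono : ∀ {n b} {f g : Vec Bool n → ℕ} → (∀ S → f S ≤ g S) → 𝔼ₛ b f ≤ 𝔼ₛ b g
  𝔼ₛ-mono = 𝔼-mono

  𝔼ₛ-+ : ∀ {n b} {f g : Vec Bool n → ℕ} → 𝔼ₛ b (λ S → f S + g S) ≡ 𝔼ₛ b f + 𝔼ₛ b g
  𝔼ₛ-+ {n} {b} {f} {g} = 𝔼-+ {n} {p = λ _ → 1} {λ _ → b} {f} {g}

  𝔼ₛ-*ˡ : ∀ {n b} c {f : Vec Bool n → ℕ} → 𝔼ₛ b (λ S → c * f S) ≡ c * 𝔼ₛ b f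
  𝔼ₛ-*ˡ {n} {b} c = 𝔼-*ˡ {n} {p = λ _ → 1} {λ _ → b} c

  𝔼ₛ-const : ∀ {n b} c → 𝔼ₛ {n} b (λ _ → c) ≡ c * suc b ^ n
  𝔼ₛ-const {n} {b} c = 𝔼-const {n} {p = λ _ → 1} {λ _ → b} c (λ _ → refl)

  𝔼ₛ-∑ : ∀ {A : Set} {n b} (xs : List A) {f : A → Vec Bool n → ℕ} → 𝔼ₛ b (λ S → ∑ xs (λ x → f x S)) ≡ ∑ xs (λ x → 𝔼ₛ b (f x))
  𝔼ₛ-∑ {n = n} {b} = 𝔼-∑ {p = λ _ → 1} {λ _ → b} (λ _ → refl)

  𝔼ₛ-min : ∀ {n} b (f : Vec Bool n → ℕ) → ∃ λ S → suc b ^ n * f S ≤ 𝔼ₛ b f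
  𝔼ₛ-min {n} b = 𝔼-min {p = λ _ → 1} {λ _ → b} (λ _ → refl)

  𝔼ₛ-lookup : ∀ {n} b (v : Fin n) → suc b * 𝔼ₛ b (λ S → ⟦ lookup S v ⟧) ≡ suc b ^ n
  𝔼ₛ-lookup {n} b v = trans (𝔼-true {p = λ _ → 1} {λ _ → b} (λ _ → refl) v) (*-identityʳ _)

  𝔼ₛ-weight : ∀ n b (B : Fin n → ℕ) → 𝔼ₛ b (weight (suc b) B) ≡ suc b ^ n
  𝔼ₛ-weight = 𝔼-weight

  𝔼ₛ-weight² : ∀ n b (B C : Fin n → ℕ) →
    𝔼ₛ b (λ S → weight (suc b) B S * weight (suc b) C S) ≡ suc b ^ n * meet (suc b) B C
  𝔼ₛ-weight² = 𝔼-weight²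

meet≤ : ∀ n b (B C : Fin n → ℕ) → meet (suc b) B C ≤ suc b ^ ∑ᵛ B
meet≤ zero    b B C = ≤-refl
meet≤ (suc n) b B C rewrite ∑ᵛ-suc B | ^-distribˡ-+-* (suc b) (B zero) (∑ᵛ (B ∘ suc)) =
  *-mono-≤ (coordinate (B zero) (C zero)) (meet≤ n b (B ∘ suc) (C ∘ suc))
  where
  coordinate : ∀ x y → meet₁ (suc b) x y ≤ suc b ^ x
  coordinate zero    y       = ≤-refl
  coordinate (suc x) zero    = m^n>0 (suc b) (suc x)
  coordinate (suc x) (suc y) = m≤m*n (suc b) (suc b ^ x) {{m^n≢0 (suc b) x}}

-- Disjoint supports give exactly 1, the part that later cancels against the squared mean. Otherwise
-- the sum on the right is at least 1 and the crude bound `meet≤` suffices.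
meet-bound : ∀ n b (B C : Fin n → ℕ) → meet (suc b) B C ≤ 1 + suc b ^ ∑ᵛ B * ∑ᵛ (λ w → B w * C w)
meet-bound zero    b B C = s≤s z≤n
meet-bound (suc n) b B C rewrite ∑ᵛ-suc (λ w → B w * C w) with meets? (B zero) (C zero)
  where
  meets? : ∀ x y → meet₁ (suc b) x y ≡ 1 ⊎ NonZero (x * y)
  meets? zero    y       = inj₁ refl
  meets? (suc x) zero    = inj₁ refl
  meets? (suc x) (suc y) = inj₂ _
... | inj₁ eq = begin
  meet₁ (suc b) (B zero) (C zero) * meet (suc b) (B ∘ suc) (C ∘ suc) ≡⟨ cong (_* meet (suc b) (B ∘ suc) (C ∘ suc)) eq ⟩
  1 * meet (suc b) (B ∘ suc) (C ∘ suc)  ≡⟨ *-identityˡ _ ⟩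
  meet (suc b) (B ∘ suc) (C ∘ suc)      ≤⟨ meet-bound n b (B ∘ suc) (C ∘ suc) ⟩
  1 + suc b ^ ∑ᵛ (B ∘ suc) * I          ≤⟨ s≤s (*-mono-≤ (^-monoʳ-≤ (suc b) tail≤) (m≤n+m I (B zero * C zero))) ⟩
  1 + suc b ^ ∑ᵛ B * (B zero * C zero + I) ∎
  where
  open ≤-Reasoning
  I = ∑ᵛ (λ w → B (suc w) * C (suc w))
  tail≤ : ∑ᵛ (B ∘ suc) ≤ ∑ᵛ B
  tail≤ = ≤-trans (m≤n+m _ (B zero)) (≤-reflexive (sym (∑ᵛ-suc B)))
... | inj₂ nz = begin
  meet (suc b) B C                          ≤⟨ meet≤ (suc n) b B C ⟩
  suc b ^ ∑ᵛ B                              ≤⟨ m≤m*n (suc b ^ ∑ᵛ B) (B zero * C zero + I) {{>-nonZero (≤-trans (>-nonZero⁻¹ _ {{nz}}) (m≤m+n _ I))}} ⟩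
  suc b ^ ∑ᵛ B * (B zero * C zero + I)      ≤⟨ n≤1+n _ ⟩
  1 + suc b ^ ∑ᵛ B * (B zero * C zero + I)  ∎
  where
  open ≤-Reasoning
  I = ∑ᵛ (λ w → B (suc w) * C (suc w))

-- The variance of a reweighted sum.

∑-* : {A B : Set} (xs : List A) (ys : List B) {f : A → ℕ} {g : B → ℕ} → ∑ xs f * ∑ ys g ≡ ∑ xs (λ x → ∑ ys (λ y → f x * g y))
∑-* xs ys {f} {g} = trans (sym (∑-*ʳ xs (∑ ys g))) (∑-cong xs (λ x → sym (∑-*ˡ ys (f x))))

module Variance {A : Set} {n : ℕ} (b : ℕ) (xs : List A) (c : A → ℕ) (B : A → Fin n → ℕ) where

  estimate : Vec Bool n → ℕ
  estimate S = ∑ xs (λ x → c x * weight (suc b) (B x) S)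

  mean : ℕ
  mean = ∑ xs c

  𝔼-estimate : 𝔼ₛ b estimate ≡ mean * suc b ^ n
  𝔼-estimate = begin
    𝔼ₛ b estimate  ≡⟨ 𝔼ₛ-∑ xs ⟩
    ∑ xs (λ x → 𝔼ₛ b (λ S → c x * weight (suc b) (B x) S)) ≡⟨ ∑-cong xs (λ x → trans (𝔼ₛ-*ˡ (c x)) (cong (c x *_) (𝔼ₛ-weight n b (B x)))) ⟩
    ∑ xs (λ x → c x * suc b ^ n)  ≡⟨ ∑-*ʳ xs (suc b ^ n) ⟩
    mean * suc b ^ n ∎
    where open ≡-Reasoning

  module _ {cmax k h : ℕ} (c≤ : ∀ x → c x ≤ cmax) (B≤ : ∀ x → ∑ᵛ (B x) ≤ k) (cover : ∀ w → ∑ xs (λ x → B x w) ≤ h) where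

    spread : ℕ
    spread = cmax * cmax * (suc b ^ k * (length xs * (k * h)))

    intersections : ∑ xs (λ x → ∑ xs (λ y → ∑ᵛ (λ w → B x w * B y w))) ≤ length xs * (k * h)
    intersections = ∑-≤-const xs (λ x → begin
      ∑ xs (λ y → ∑ᵛ (λ w → B x w * B y w))  ≡⟨ ∑-swap xs (allFin n) ⟩
      ∑ᵛ (λ w → ∑ xs (λ y → B x w * B y w))  ≡⟨ ∑-cong (allFin n) (λ w → ∑-*ˡ xs (B x w)) ⟩
      ∑ᵛ (λ w → B x w * ∑ xs (λ y → B y w))  ≤⟨ ∑-mono (allFin n) (λ w → *-monoʳ-≤ (B x w) (cover w)) ⟩
      ∑ᵛ (λ w → B x w * h)                   ≡⟨ ∑-*ʳ (allFin n) h ⟩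
      ∑ᵛ (B x) * h                           ≤⟨ *-monoˡ-≤ h (B≤ x) ⟩
      k * h                                  ∎)
      where open ≤-Reasoning

    -- Over all pairs the 1 in `meet-bound` adds up to mean², and the remainder to `spread`, which
    -- is only linear in `length xs` because few pairs meet.
    𝔼-estimate² : 𝔼ₛ b (λ S → estimate S * estimate S) ≤ suc b ^ n * (mean * mean + spread)
    𝔼-estimate² = begin
      𝔼ₛ b (λ S → estimate S * estimate S)
        ≡⟨ 𝔼ₛ-cong (λ S → ∑-* xs xs) ⟩
      𝔼ₛ b (λ S → ∑ xs (λ x → ∑ xs (λ y → (c x * W x S) * (c y * W y S))))
        ≡⟨ 𝔼ₛ-∑ xs ⟩
      ∑ xs (λ x → 𝔼ₛ b (λ S → ∑ xs (λ y → (c x * W x S) * (c y * W y S))))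
        ≡⟨ ∑-cong xs (λ x → 𝔼ₛ-∑ xs) ⟩
      ∑ xs (λ x → ∑ xs (λ y → 𝔼ₛ b (λ S → (c x * W x S) * (c y * W y S))))
        ≤⟨ ∑-mono xs (λ x → ∑-mono xs (λ y → pair x y)) ⟩
      ∑ xs (λ x → ∑ xs (λ y → N * (c x * c y + M * I x y)))
        ≡⟨ trans (∑-cong xs (λ x → ∑-*ˡ xs N)) (∑-*ˡ xs N) ⟩
      N * ∑ xs (λ x → ∑ xs (λ y → c x * c y + M * I x y))
        ≡⟨ cong (N *_) (trans (∑-cong xs (λ x → ∑-+ xs)) (∑-+ xs)) ⟩
      N * (∑ xs (λ x → ∑ xs (λ y → c x * c y)) + ∑ xs (λ x → ∑ xs (λ y → M * I x y)))
        ≡⟨ cong₂ (λ p q → N * (p + q)) (sym (∑-* xs xs)) (trans (∑-cong xs (λ x → ∑-*ˡ xs M)) (∑-*ˡ xs M)) ⟩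
      N * (mean * mean + M * ∑ xs (λ x → ∑ xs (I x)))
        ≤⟨ *-monoʳ-≤ N (+-monoʳ-≤ (mean * mean) (*-monoʳ-≤ M intersections)) ⟩
      N * (mean * mean + M * (length xs * (k * h)))
        ≡⟨ cong (λ z → N * (mean * mean + z)) (*-assoc (cmax * cmax) (suc b ^ k) _) ⟩
      N * (mean * mean + spread) ∎
      where
      open ≤-Reasoning
      N = suc b ^ n
      M = cmax * cmax * suc b ^ k
      W : A → Vec Bool n → ℕ
      W x = weight (suc b) (B x)
      I : A → A → ℕ
      I x y = ∑ᵛ (λ w → B x w * B y w)
      shuffle : ∀ a u d v → (a * u) * (d * v) ≡ a * d * (u * v)
      shuffle = solve-∀
      shuffle′ : ∀ a N s → a * (N * s) ≡ N * (a * s)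
      shuffle′ = solve-∀
      shuffle″ : ∀ a p i → a * (1 + p * i) ≡ a + a * p * i
      shuffle″ = solve-∀
      pair : ∀ x y → 𝔼ₛ b (λ S → (c x * W x S) * (c y * W y S)) ≤ N * (c x * c y + M * I x y)
      pair x y = begin
        𝔼ₛ b (λ S → (c x * W x S) * (c y * W y S)) ≡⟨ 𝔼ₛ-cong (λ S → shuffle (c x) (W x S) (c y) (W y S)) ⟩
        𝔼ₛ b (λ S → c x * c y * (W x S * W y S))   ≡⟨ 𝔼ₛ-*ˡ (c x * c y) ⟩
        c x * c y * 𝔼ₛ b (λ S → W x S * W y S)     ≡⟨ cong (c x * c y *_) (𝔼ₛ-weight² n b (B x) (B y)) ⟩
        c x * c y * (N * meet (suc b) (B x) (B y)) ≤⟨ *-monoʳ-≤ (c x * c y) (*-monoʳ-≤ N (meet-bound n b (B x) (B y))) ⟩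
        c x * c y * (N * (1 + suc b ^ ∑ᵛ (B x) * I x y)) ≡⟨ shuffle′ (c x * c y) N _ ⟩
        N * (c x * c y * (1 + suc b ^ ∑ᵛ (B x) * I x y)) ≡⟨ cong (N *_) (shuffle″ (c x * c y) (suc b ^ ∑ᵛ (B x)) (I x y)) ⟩
        N * (c x * c y + c x * c y * suc b ^ ∑ᵛ (B x) * I x y)
          ≤⟨ *-monoʳ-≤ N (+-monoʳ-≤ (c x * c y) (*-monoˡ-≤ (I x y) (*-mono-≤ (*-mono-≤ (c≤ x) (c≤ y)) (^-monoʳ-≤ (suc b) (B≤ x))))) ⟩
        N * (c x * c y + M * I x y) ∎

    error² : Vec Bool n → ℕ
    error² S = ∣ estimate S - mean ∣ * ∣ estimate S - mean ∣

    variance : 𝔼ₛ b error² ≤ suc b ^ n * spread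
    -- The added term is twice the mean times the expected estimate, rewritten by unbiasedness; it
    -- replaces the subtraction in 𝔼 Z² - mean².
    variance = +-cancelʳ-≤ (2 * (mean * mean * N)) _ _ (begin
      𝔼ₛ b error² + 2 * (mean * mean * N)
        ≡⟨ cong (𝔼ₛ b error² +_) (shuffle mean N) ⟩
      𝔼ₛ b error² + 2 * mean * (mean * N)
        ≡⟨ cong (λ z → 𝔼ₛ b error² + 2 * mean * z) 𝔼-estimate ⟨
      𝔼ₛ b error² + 2 * mean * 𝔼ₛ b estimate
        ≡⟨ cong (𝔼ₛ b error² +_) (𝔼ₛ-*ˡ (2 * mean)) ⟨
      𝔼ₛ b error² + 𝔼ₛ b (λ S → 2 * mean * estimate S)
        ≡⟨ 𝔼ₛ-+ {f = error²} ⟨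
      𝔼ₛ b (λ S → error² S + 2 * mean * estimate S)
        ≡⟨ 𝔼ₛ-cong (λ S → trans (cong (error² S +_) (shuffle′ mean (estimate S))) (dist² (estimate S) mean)) ⟩
      𝔼ₛ b (λ S → estimate S * estimate S + mean * mean)
        ≡⟨ 𝔼ₛ-+ {f = λ S → estimate S * estimate S} {λ _ → mean * mean} ⟩
      𝔼ₛ b (λ S → estimate S * estimate S) + 𝔼ₛ {n} b (λ _ → mean * mean)
        ≤⟨ +-mono-≤ 𝔼-estimate² (≤-reflexive (𝔼ₛ-const (mean * mean))) ⟩
      N * (mean * mean + spread) + mean * mean * N
        ≡⟨ shuffle″ N (mean * mean) spread ⟩
      N * spread + 2 * (mean * mean * N) ∎)
      where
      open ≤-Reasoning
      N = suc b ^ n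
      shuffle : ∀ m N → 2 * (m * m * N) ≡ 2 * m * (m * N)
      shuffle = solve-∀
      shuffle′ : ∀ m z → 2 * m * z ≡ 2 * (z * m)
      shuffle′ = solve-∀
      shuffle″ : ∀ N m s → N * (m + s) + m * N ≡ N * s + 2 * (m * N)
      shuffle″ = solve-∀

-- The estimator and its failure probability.

Valid : {n : ℕ} → ℕ → List (Edge n) → Set
Valid D E = NoLoops E × (∀ v → deg E v ≤ D)

size : {n : ℕ} → Vec Bool n → ℕ
size S = ∑ᵛ (λ v → ⟦ lookup S v ⟧)

⟦∨⟧ : ∀ a b → ⟦ a ∨ b ⟧ ≤ ⟦ a ⟧ + ⟦ b ⟧
⟦∨⟧ true  b = s≤s z≤n
⟦∨⟧ false b = ≤-refl

-- Markov's inequality for the sample size, whose mean is n / suc b. With `suc n` in the hypothesis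
-- there is a positive factor to cancel even for n = 0.
markov : ∀ {n} b cap A → A * suc n ≤ suc b * cap → A * 𝔼ₛ {n} b (λ S → ⟦ ⌊ cap <? size S ⌋ ⟧) ≤ suc b ^ n
markov {n} b cap A bound = *-cancelˡ-≤ (suc n) (begin
  suc n * (A * o)                   ≡⟨ shuffle (suc n) A o ⟩
  A * suc n * o                     ≤⟨ *-monoˡ-≤ o bound ⟩
  suc b * cap * o                   ≡⟨ *-assoc (suc b) cap o ⟩
  suc b * (cap * o)                 ≡⟨ cong (suc b *_) (𝔼ₛ-*ˡ cap) ⟨
  suc b * 𝔼ₛ b (λ S → cap * over S) ≤⟨ *-monoʳ-≤ (suc b) (𝔼ₛ-mono over≤) ⟩
  suc b * 𝔼ₛ b (size {n})           ≡⟨ cong (suc b *_) (𝔼ₛ-∑ (allFin n)) ⟩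
  suc b * ∑ᵛ {n} (λ v → 𝔼ₛ b (λ S → ⟦ lookup S v ⟧)) ≡⟨ ∑-*ˡ (allFin n) (suc b) ⟨
  ∑ᵛ {n} (λ v → suc b * 𝔼ₛ b (λ S → ⟦ lookup S v ⟧)) ≡⟨ ∑-cong (allFin n) (𝔼ₛ-lookup b) ⟩
  ∑ᵛ {n} (λ _ → N)                  ≡⟨ ∑-const (allFin n) N ⟩
  length (allFin n) * N             ≡⟨ cong (_* N) (length-tabulate {n = n} id) ⟩
  n * N                             ≤⟨ *-monoˡ-≤ N (n≤1+n n) ⟩
  suc n * N                         ∎)
  where
  open ≤-Reasoning
  N = suc b ^ n
  over : Vec Bool n → ℕ
  over S = ⟦ ⌊ cap <? size S ⌋ ⟧
  o = 𝔼ₛ b over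
  shuffle : ∀ n a o → n * (a * o) ≡ a * n * o
  shuffle = solve-∀
  over≤ : ∀ S → cap * over S ≤ size S
  over≤ S with cap <? size S
  ... | yes lt = ≤-trans (≤-reflexive (*-identityʳ cap)) (<⇒≤ lt)
  ... | no _   = ≤-trans (≤-reflexive (*-zeroʳ cap)) z≤n

module Estimator {n : ℕ} (D K T b : ℕ) where
  open Ascent {n} K

  -- The index `suc T` makes every ball contain the endpoints of its edge, so an edge of non-zero
  -- weight touches the sample and is stored.
  estimator : Vec Bool n → List (Edge n) → ℕ
  estimator S E = ∑ E (λ e → φ E (suc T) e * weight (suc b) (ball E (suc T) e) S)

  -- A ball computed from the stored edges could lie in S while the true ball does not, or
  -- conversely. Agreement is symmetric, so locality applies from whichever side has non-zero weight
  -- and identifies the two; edges that are not stored have weight 0.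
  estimator-sample : ∀ S E → estimator S (sample S E) ≡ estimator S E
  estimator-sample S E = begin
    ∑ E′ (term E′)  ≡⟨ ∑-cong E′ same ⟩
    ∑ E′ (term E)   ≡⟨ ∑-filter (λ e → T? (touches S e)) E untouched ⟩
    ∑ E (term E)    ∎
    where
    open ≡-Reasoning
    E′ = sample S E
    term : List (Edge n) → Edge n → ℕ
    term F e = φ F (suc T) e * weight (suc b) (ball F (suc T) e) S
    zero-term : ∀ F e → weight (suc b) (ball F (suc T) e) S ≡ 0 → term F e ≡ 0
    zero-term F e z = trans (cong (φ F (suc T) e *_) z) (*-zeroʳ (φ F (suc T) e))
    agree-term : ∀ {F F′} → Agree S F F′ → ∀ e → ¬ (weight (suc b) (ball F (suc T) e) S ≡ 0) → term F′ e ≡ term F e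
    agree-term {F} {F′} agree e w≢0 = cong₂ _*_ (φ-local K {S} agree (suc T) e ins) (weight-cong (ball-local K {S} agree (suc T) e ins) S)
      where
      ins : Inside S (ball F (suc T) e)
      ins = weight-inside S w≢0
    same : ∀ e → term E′ e ≡ term E e
    same e with weight (suc b) (ball E′ (suc T) e) S ≟ⁿ 0 | weight (suc b) (ball E (suc T) e) S ≟ⁿ 0
    ... | yes z | yes z′ = trans (zero-term E′ e z) (sym (zero-term E e z′))
    ... | no w  | _      = sym (agree-term (sample-agree S E) e w)
    ... | yes _ | no w   = agree-term (λ v v∈S f g → sym (sample-agree S E v v∈S f g)) e w
    untouched : ∀ e → ¬ Bool.T (touches S e) → term E e ≡ 0
    untouched e@(u , v) nt with weight (suc b) (ball E (suc T) e) S ≟ⁿ 0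
    ... | yes z = zero-term E e z
    ... | no w  = ⊥-elim (nt (∨-introˡ (lookup S v) (weight-inside S w u (λ z → self∈walks K E T u (m+n≡0⇒m≡0 _ z)))))

  Φ : List (Edge n) → ℕ
  Φ E = ∑ E (φ E (suc T))

  far : List (Edge n) → Vec Bool n → Bool
  far E S = ⌊ length E <? ∣ estimator S E - Φ E ∣ ⌋

  radius : ℕ
  radius = 2 * ballSize D (suc T)

  noise : ℕ
  noise = suc T * K * (suc T * K) * (suc b ^ radius * (radius * (D * ballSize D (suc T))))

  -- The variance is at most `noise` times |E| and the allowed deviation is |E|, so the failure
  -- probability is at most noise / |E|.
  chebyshev : ∀ A E → Valid D E → A * noise < length E → A * 𝔼ₛ b (λ S → ⟦ far E S ⟧) ≤ suc b ^ n
  chebyshev A E (_ , dg) large = *-cancelˡ-≤ (m * m) {{m*n≢0 m m}} (begin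
    m * m * (A * o)                      ≡⟨ shuffle m A o ⟩
    A * (m * m * o)                      ≡⟨ cong (A *_) (𝔼ₛ-*ˡ (m * m)) ⟨
    A * 𝔼ₛ b (λ S → m * m * ⟦ far E S ⟧) ≤⟨ *-monoʳ-≤ A (𝔼ₛ-mono far≤) ⟩
    A * 𝔼ₛ b (error² bounds balls covers) ≤⟨ *-monoʳ-≤ A (variance bounds balls covers) ⟩
    A * (N * (c * (q * (m * kh))))       ≡⟨ shuffle′ A N c q m kh ⟩
    N * (A * (c * (q * kh))) * m         ≤⟨ *-monoˡ-≤ m (*-monoʳ-≤ N (<⇒≤ large)) ⟩
    N * m * m                            ≡⟨ shuffle″ N m ⟩
    m * m * N                            ∎)
    where
    open ≤-Reasoning
    open Variance b E (φ E (suc T)) (ball E (suc T))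
    m = length E
    N = suc b ^ n
    c = suc T * K * (suc T * K)
    q = suc b ^ radius
    kh = radius * (D * ballSize D (suc T))
    o = 𝔼ₛ b (λ S → ⟦ far E S ⟧)
    bounds = φ≤ E (suc T)
    balls = ball-size E dg (suc T)
    covers = ball-cover E dg (suc T)
    instance
      m≢0 : NonZero m
      m≢0 = >-nonZero (≤-trans (s≤s z≤n) large)
    shuffle : ∀ m a o → m * m * (a * o) ≡ a * (m * m * o)
    shuffle = solve-∀
    shuffle′ : ∀ a n c q m k → a * (n * (c * (q * (m * k)))) ≡ n * (a * (c * (q * k))) * m
    shuffle′ = solve-∀
    shuffle″ : ∀ n m → n * m * m ≡ m * m * n
    shuffle″ = solve-∀
    far≤ : ∀ S → m * m * ⟦ far E S ⟧ ≤ error² bounds balls covers S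
    far≤ S with m <? ∣ estimator S E - Φ E ∣
    ... | yes lt = ≤-trans (≤-reflexive (*-identityʳ (m * m))) (*-mono-≤ (<⇒≤ lt) (<⇒≤ lt))
    ... | no _   = ≤-trans (≤-reflexive (*-zeroʳ (m * m))) z≤n

  -- Inaccuracy counts as failure only for streams longer than `L`: shorter ones are stored and
  -- answered exactly, and Chebyshev's inequality needs |E| to exceed a multiple of `noise`.
  bad : (L cap : ℕ) → List (Edge n) → Vec Bool n → Bool
  bad L cap E S = ⌊ cap <? size S ⌋ ∨ (⌊ L <? length E ⌋ ∧ far E S)

  bad-rare : ∀ A L cap → 2 * A * suc n ≤ suc b * cap → 2 * A * noise ≤ L →
    ∀ E → Valid D E → A * 𝔼ₛ b (λ S → ⟦ bad L cap E S ⟧) ≤ suc b ^ n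
  bad-rare A L cap hcap hL E val = *-cancelˡ-≤ 2 (begin
    2 * (A * 𝔼ₛ b (λ S → ⟦ bad L cap E S ⟧))  ≡⟨ *-assoc 2 A _ ⟨
    2 * A * 𝔼ₛ b (λ S → ⟦ bad L cap E S ⟧)    ≤⟨ *-monoʳ-≤ (2 * A) (𝔼ₛ-mono (λ S → ⟦∨⟧ ⌊ cap <? size S ⌋ _)) ⟩
    2 * A * 𝔼ₛ b (λ S → ⟦ ⌊ cap <? size S ⌋ ⟧ + ⟦ ⌊ L <? length E ⌋ ∧ far E S ⟧)  ≡⟨ cong (2 * A *_) 𝔼ₛ-+ ⟩
    2 * A * (𝔼ₛ b (λ S → ⟦ ⌊ cap <? size S ⌋ ⟧) + 𝔼ₛ b (λ S → ⟦ ⌊ L <? length E ⌋ ∧ far E S ⟧))  ≡⟨ *-distribˡ-+ (2 * A) _ _ ⟩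
    2 * A * 𝔼ₛ b (λ S → ⟦ ⌊ cap <? size S ⌋ ⟧) + 2 * A * 𝔼ₛ b (λ S → ⟦ ⌊ L <? length E ⌋ ∧ far E S ⟧)
      ≤⟨ +-mono-≤ (markov b cap (2 * A) hcap) far-rare ⟩
    suc b ^ n + suc b ^ n                     ≡⟨ cong (suc b ^ n +_) (+-identityʳ _) ⟨
    2 * suc b ^ n                             ∎)
    where
    open ≤-Reasoning
    far-rare : 2 * A * 𝔼ₛ b (λ S → ⟦ ⌊ L <? length E ⌋ ∧ far E S ⟧) ≤ suc b ^ n
    far-rare with L <? length E
    ... | yes lt = chebyshev (2 * A) E val (≤-<-trans hL lt)
    ... | no _   = ≤-trans (≤-reflexive (trans (cong (2 * A *_) (𝔼ₛ-const 0)) (*-zeroʳ (2 * A)))) z≤n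

  bad-false : ∀ L cap E S → bad L cap E S ≡ false →
    (size S ≤ cap) × (L < length E → ∣ estimator S E - Φ E ∣ ≤ length E)
  bad-false L cap E S ok with cap <? size S | L <? length E | length E <? ∣ estimator S E - Φ E ∣ | ok
  ... | no small | _       | no near | _  = ≮⇒≥ small , λ _ → ≮⇒≥ near
  ... | no small | no ≤L   | yes _   | _  = ≮⇒≥ small , λ L< → ⊥-elim (≤L L<)
  ... | no _     | yes _   | yes _   | ()
  ... | yes _    | _       | _       | ()

-- Newman's theorem: a fixed table of samples.

count-allBits : ∀ s (p : Bits (suc s) → Bool) →
  count p (allBits (suc s)) ≡ count (p ∘ (true ∷_)) (allBits s) + count (p ∘ (false ∷_)) (allBits s)
count-allBits s p = go (allBits s)
  where
  shuffle : ∀ a b c d → a + (b + (c + d)) ≡ a + c + (b + d)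
  shuffle = solve-∀
  go : ∀ ws → count p (concatMap (λ w → (true ∷ w) ∷ (false ∷ w) ∷ []) ws) ≡ count (p ∘ (true ∷_)) ws + count (p ∘ (false ∷_)) ws
  go []       = refl
  go (w ∷ ws) = trans (cong (λ z → ⟦ p (true ∷ w) ⟧ + (⟦ p (false ∷ w) ⟧ + z)) (go ws))
    (shuffle ⟦ p (true ∷ w) ⟧ ⟦ p (false ∷ w) ⟧ _ _)

-- The 2^s samples are chosen one at a time, each at most doubling the sum over the inputs of
-- (2^a)^(number of samples so far that are bad for the input).
module Newman {I : Set} (inputs : List I) {n : ℕ} (b a : ℕ) (bad : I → Vec Bool n → Bool)
  (rare : ∀ {i} → i ∈ inputs → 2 ^ a * 𝔼ₛ b (λ S → ⟦ bad i S ⟧) ≤ suc b ^ n) where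

  -- `wt` is the potential left by the samples chosen so far: the second half of the table is picked
  -- with the outcome of the first half as its weights.
  pick : ∀ s (wt : I → ℕ) → ∃ λ (table : Bits s → Vec Bool n) →
    ∑ inputs (λ i → wt i * (2 ^ a) ^ count (bad i ∘ table) (allBits s)) ≤ 2 ^ (2 ^ s) * ∑ inputs wt
  pick zero wt with 𝔼ₛ-min {n} b (λ S → ∑ inputs (λ i → wt i * (2 ^ a) ^ (⟦ bad i S ⟧ + 0)))
  ... | S , least = (λ _ → S) , *-cancelˡ-≤ N {{m^n≢0 (suc b) n}} (begin
    N * ∑ inputs (λ i → wt i * (2 ^ a) ^ (⟦ bad i S ⟧ + 0))          ≤⟨ least ⟩
    𝔼ₛ b (λ S → ∑ inputs (λ i → wt i * (2 ^ a) ^ (⟦ bad i S ⟧ + 0))) ≡⟨ 𝔼ₛ-∑ inputs ⟩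
    ∑ inputs (λ i → 𝔼ₛ b (λ S → wt i * (2 ^ a) ^ (⟦ bad i S ⟧ + 0))) ≤⟨ ∑-mono-∈ inputs average ⟩
    ∑ inputs (λ i → 2 * N * wt i)                                    ≡⟨ ∑-*ˡ inputs (2 * N) ⟩
    2 * N * ∑ inputs wt                                              ≡⟨ shuffle N (∑ inputs wt) ⟩
    N * (2 * ∑ inputs wt)                                            ∎)
    where
    open ≤-Reasoning
    N = suc b ^ n
    shuffle : ∀ N w → 2 * N * w ≡ N * (2 * w)
    shuffle = solve-∀
    shuffle′ : ∀ N w → w * (N + N) ≡ 2 * N * w
    shuffle′ = solve-∀
    -- By `rare` the second summand has mean at most 1, so one more sample at most doubles the
    -- potential.
    power≤ : ∀ x → (2 ^ a) ^ (⟦ x ⟧ + 0) ≤ 1 + 2 ^ a * ⟦ x ⟧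
    power≤ true  = n≤1+n _
    power≤ false = s≤s z≤n
    average : ∀ {i} → i ∈ inputs → 𝔼ₛ b (λ S → wt i * (2 ^ a) ^ (⟦ bad i S ⟧ + 0)) ≤ 2 * N * wt i
    average {i} i∈ = begin
      𝔼ₛ b (λ S → wt i * (2 ^ a) ^ (⟦ bad i S ⟧ + 0))     ≡⟨ 𝔼ₛ-*ˡ (wt i) ⟩
      wt i * 𝔼ₛ b (λ S → (2 ^ a) ^ (⟦ bad i S ⟧ + 0))     ≤⟨ *-monoʳ-≤ (wt i) (𝔼ₛ-mono (λ S → power≤ (bad i S))) ⟩
      wt i * 𝔼ₛ b (λ S → 1 + 2 ^ a * ⟦ bad i S ⟧)         ≡⟨ cong (wt i *_) 𝔼ₛ-+ ⟩
      wt i * (𝔼ₛ {n} b (λ S → 1) + 𝔼ₛ b (λ S → 2 ^ a * ⟦ bad i S ⟧)) ≡⟨ cong₂ (λ x y → wt i * (x + y)) (trans (𝔼ₛ-const 1) (*-identityˡ N)) (𝔼ₛ-*ˡ (2 ^ a)) ⟩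
      wt i * (N + 2 ^ a * 𝔼ₛ b (λ S → ⟦ bad i S ⟧))       ≤⟨ *-monoʳ-≤ (wt i) (+-monoʳ-≤ N (rare i∈)) ⟩
      wt i * (N + N)                                       ≡⟨ shuffle′ N (wt i) ⟩
      2 * N * wt i                                         ∎
  pick (suc s) wt with pick s wt
  ... | t₁ , h₁ with pick s (λ i → wt i * (2 ^ a) ^ count (bad i ∘ t₁) (allBits s))
  ... | t₂ , h₂ = table , (begin
    ∑ inputs (λ i → wt i * (2 ^ a) ^ count (bad i ∘ table) (allBits (suc s)))  ≡⟨ ∑-cong inputs split ⟩
    ∑ inputs (λ i → wt i * (2 ^ a) ^ c₁ i * (2 ^ a) ^ c₂ i)                    ≤⟨ h₂ ⟩
    2 ^ (2 ^ s) * ∑ inputs (λ i → wt i * (2 ^ a) ^ c₁ i)                       ≤⟨ *-monoʳ-≤ (2 ^ (2 ^ s)) h₁ ⟩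
    2 ^ (2 ^ s) * (2 ^ (2 ^ s) * ∑ inputs wt)                                  ≡⟨ *-assoc (2 ^ (2 ^ s)) (2 ^ (2 ^ s)) _ ⟨
    2 ^ (2 ^ s) * 2 ^ (2 ^ s) * ∑ inputs wt                                    ≡⟨ cong (_* ∑ inputs wt) (^-distribˡ-+-* 2 (2 ^ s) (2 ^ s)) ⟨
    2 ^ (2 ^ s + 2 ^ s) * ∑ inputs wt                                          ≡⟨ cong (λ z → 2 ^ (2 ^ s + z) * ∑ inputs wt) (+-identityʳ (2 ^ s)) ⟨
    2 ^ (2 ^ suc s) * ∑ inputs wt                                              ∎)
    where
    open ≤-Reasoning
    table : Bits (suc s) → Vec Bool n
    table (true  ∷ w) = t₁ w
    table (false ∷ w) = t₂ w
    c₁ c₂ : I → ℕ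
    c₁ i = count (bad i ∘ t₁) (allBits s)
    c₂ i = count (bad i ∘ t₂) (allBits s)
    split : ∀ i → wt i * (2 ^ a) ^ count (bad i ∘ table) (allBits (suc s)) ≡ wt i * (2 ^ a) ^ c₁ i * (2 ^ a) ^ c₂ i
    split i = trans (cong (λ z → wt i * (2 ^ a) ^ z) (count-allBits s (bad i ∘ table)))
      (trans (cong (wt i *_) (^-distribˡ-+-* (2 ^ a) (c₁ i) (c₂ i))) (sym (*-assoc (wt i) _ _)))

  -- The potential starts at the number of inputs, at most 2^(2^s), and ends at most at 2^(2 * 2^s).
  -- It dominates the term of each single input, so at most a fraction 2 / a of the seeds is bad for
  -- that input.
  newman : ∀ s → length inputs ≤ 2 ^ (2 ^ s) → ∃ λ (table : Bits s → Vec Bool n) →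
    ∀ {i} → i ∈ inputs → a * count (bad i ∘ table) (allBits s) ≤ 2 * 2 ^ s
  newman s few with pick s (λ _ → 1)
  ... | table , h = table , λ {i} i∈ → ≮⇒≥ (λ lt → <⇒≱ (^-monoʳ-< 2 (s≤s (s≤s z≤n)) lt) (begin
    2 ^ (a * c i)                    ≡⟨ ^-*-assoc 2 a (c i) ⟨
    (2 ^ a) ^ c i                    ≡⟨ *-identityˡ _ ⟨
    1 * (2 ^ a) ^ c i                ≤⟨ ∑-∈ (λ i → 1 * (2 ^ a) ^ c i) i∈ ⟩
    ∑ inputs (λ i → 1 * (2 ^ a) ^ c i) ≤⟨ h ⟩
    2 ^ (2 ^ s) * ∑ inputs (λ _ → 1) ≡⟨ cong (2 ^ (2 ^ s) *_) (trans (∑-const inputs 1) (*-identityʳ _)) ⟩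
    2 ^ (2 ^ s) * length inputs      ≤⟨ *-monoʳ-≤ (2 ^ (2 ^ s)) few ⟩
    2 ^ (2 ^ s) * 2 ^ (2 ^ s)        ≡⟨ ^-distribˡ-+-* 2 (2 ^ s) (2 ^ s) ⟨
    2 ^ (2 ^ s + 2 ^ s)              ≡⟨ cong (λ z → 2 ^ (2 ^ s + z)) (+-identityʳ (2 ^ s)) ⟨
    2 ^ (2 * 2 ^ s)                  ∎))
    where
    open ≤-Reasoning
    c : I → ℕ
    c i = count (bad i ∘ table) (allBits s)

-- Enumeration of the possible inputs.

length-cartesianProductWith : {A B C : Set} (f : A → B → C) (xs : List A) (ys : List B) →
  length (cartesianProductWith f xs ys) ≡ length xs * length ys
length-cartesianProductWith f []       ys = refl
length-cartesianProductWith f (x ∷ xs) ys = trans (length-++ (map (f x) ys))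
  (cong₂ _+_ (length-map (f x) ys) (length-cartesianProductWith f xs ys))

allEdges : (n : ℕ) → List (Edge n)
allEdges n = cartesianProduct (allFin n) (allFin n)

streams : (n ℓ : ℕ) → List (List (Edge n))
streams n zero    = [] ∷ []
streams n (suc ℓ) = [] ∷ cartesianProductWith _∷_ (allEdges n) (streams n ℓ)

streams-complete : ∀ {n} ℓ (E : List (Edge n)) → length E ≤ ℓ → E ∈ streams n ℓ
streams-complete zero    []            le = here refl
streams-complete (suc ℓ) []            le = here refl
streams-complete (suc ℓ) ((u , v) ∷ E) (s≤s le) = there
  (∈-cartesianProductWith⁺ _∷_ (∈-cartesianProduct⁺ (∈-allFin u) (∈-allFin v)) (streams-complete ℓ E le))

length-streams : ∀ n ℓ → length (streams n ℓ) ≤ (1 + n * n) ^ ℓ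
length-streams n zero    = s≤s z≤n
length-streams n (suc ℓ) = begin
  1 + length (cartesianProductWith _∷_ (allEdges n) (streams n ℓ))  ≡⟨ cong suc (length-cartesianProductWith _∷_ (allEdges n) (streams n ℓ)) ⟩
  1 + length (allEdges n) * length (streams n ℓ)                    ≡⟨ cong (λ z → 1 + z * length (streams n ℓ)) edges ⟩
  1 + n * n * length (streams n ℓ)                                  ≤⟨ +-mono-≤ (m^n>0 (1 + n * n) ℓ) (*-monoʳ-≤ (n * n) (length-streams n ℓ)) ⟩
  (1 + n * n) ^ ℓ + n * n * (1 + n * n) ^ ℓ                         ∎
  where
  open ≤-Reasoning
  edges : length (allEdges n) ≡ n * n
  edges = trans (length-cartesianProductWith _,_ (allFin n) (allFin n)) (cong₂ _*_ (length-tabulate {n = n} id) (length-tabulate {n = n} id))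

valid? : ∀ {n} D (E : List (Edge n)) → Dec (Valid D E)
valid? D E = All.all? (λ e → ¬? (proj₁ e ≟ proj₂ e)) E ×-dec all? (λ v → deg E v ≤? D)

-- Bit encodings and the streaming machine.

take-++ : {A : Set} {m n : ℕ} (xs : Vec A m) (ys : Vec A n) → Vec.take m (xs Vec.++ ys) ≡ xs
take-++ []       ys = refl
take-++ (x ∷ xs) ys = cong (x ∷_) (take-++ xs ys)

drop-++ : {A : Set} {m n : ℕ} (xs : Vec A m) (ys : Vec A n) → Vec.drop m (xs Vec.++ ys) ≡ ys
drop-++ []       ys = refl
drop-++ (x ∷ xs) ys = drop-++ xs ys

toBits : ∀ w → ℕ → Bits w
toBits zero    x = []
toBits (suc w) x with 2 ^ w ≤? x
... | yes _ = true ∷ toBits w (x ∸ 2 ^ w)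
... | no _  = false ∷ toBits w x

fromBits : ∀ {w} → Bits w → ℕ
fromBits []          = 0
fromBits {suc w} (b ∷ v) = ⟦ b ⟧ * 2 ^ w + fromBits v

fromBits-toBits : ∀ w x → x < 2 ^ w → fromBits (toBits w x) ≡ x
fromBits-toBits zero    zero    lt = refl
fromBits-toBits zero    (suc x) (s≤s ())
fromBits-toBits (suc w) x       lt with 2 ^ w ≤? x
... | yes le = trans (cong₂ _+_ (*-identityˡ (2 ^ w)) (fromBits-toBits w (x ∸ 2 ^ w) smaller)) (m+[n∸m]≡n le)
  where
  smaller : x ∸ 2 ^ w < 2 ^ w
  smaller = +-cancelˡ-< (2 ^ w) _ _ (≤-trans (≤-reflexive (cong suc (m+[n∸m]≡n le))) (≤-trans lt (≤-reflexive (cong (2 ^ w +_) (+-identityʳ (2 ^ w))))))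
... | no gt  = fromBits-toBits w x (≰⇒> gt)

module Codec {n : ℕ} (w : ℕ) (n≤2^w : n ≤ 2 ^ w) where

  encEdge : Edge n → Bits (w + w)
  encEdge (u , v) = toBits w (toℕ u) Vec.++ toBits w (toℕ v)

  decVertex : ℕ → Maybe (Fin n)
  decVertex x with x <? n
  ... | yes lt = just (fromℕ< lt)
  ... | no _   = nothing

  decEdge : Bits (w + w) → Maybe (Edge n)
  decEdge bs = Maybe.zip (decVertex (fromBits (Vec.take w bs))) (decVertex (fromBits (Vec.drop w bs)))

  decVertex-toBits : ∀ u → decVertex (fromBits (toBits w (toℕ u))) ≡ just u
  decVertex-toBits u rewrite fromBits-toBits w (toℕ u) (≤-trans (toℕ<n u) n≤2^w) with toℕ u <? n
  ... | yes lt = cong just (fromℕ<-toℕ u lt)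
  ... | no ge  = ⊥-elim (ge (toℕ<n u))

  decEdge-encEdge : ∀ e → decEdge (encEdge e) ≡ just e
  decEdge-encEdge (u , v)
    rewrite take-++ (toBits w (toℕ u)) (toBits w (toℕ v)) | drop-++ (toBits w (toℕ u)) (toBits w (toℕ v))
          | decVertex-toBits u | decVertex-toBits v = refl

  slot : ℕ
  slot = suc (w + w)

  -- A flag bit says whether a further edge follows. Edges beyond `L` are dropped, so an overflowing
  -- buffer is legal and merely loses its tail.
  encList : ∀ L → List (Edge n) → Bits (L * slot)
  encList zero    es       = []
  encList (suc L) []       = false ∷ Vec.replicate _ false
  encList (suc L) (e ∷ es) = true ∷ (encEdge e Vec.++ encList L es)

  cons? : Maybe (Edge n) → List (Edge n) → List (Edge n)
  cons? (just e) es = e ∷ es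
  cons? nothing  es = []

  decList : ∀ L → Bits (L * slot) → List (Edge n)
  decList zero    bs           = []
  decList (suc L) (false ∷ bs) = []
  decList (suc L) (true ∷ bs)  = cons? (decEdge (Vec.take (w + w) bs)) (decList L (Vec.drop (w + w) bs))

  decList-encList : ∀ L es → decList L (encList L es) ≡ take L es
  decList-encList zero    es       = refl
  decList-encList (suc L) []       = refl
  decList-encList (suc L) (e ∷ es)
    rewrite take-++ (encEdge e) (encList L es) | drop-++ (encEdge e) (encList L es) | decEdge-encEdge e
    = cong (e ∷_) (decList-encList L es)

  -- Keeps `state` an exact invariant even after an overflow: the machine appends to the decoded,
  -- already truncated list, while `state` speaks of the full one.
  encList-take : ∀ L es fs → encList L (take L es ++ fs) ≡ encList L (es ++ fs)
  encList-take zero    es       fs = refl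
  encList-take (suc L) []       fs = refl
  encList-take (suc L) (e ∷ es) fs = cong (λ z → true ∷ (encEdge e Vec.++ z)) (encList-take L es fs)

  module Machine (cw L₁ L₂ : ℕ) where

    space : ℕ
    space = cw + (L₁ * slot + L₂ * slot)

    enc : ℕ → List (Edge n) → List (Edge n) → Bits space
    enc m xs ys = toBits cw m Vec.++ (encList L₁ xs Vec.++ encList L₂ ys)

    counter : Bits space → ℕ
    counter σ = fromBits (Vec.take cw σ)

    prefix sampled : Bits space → List (Edge n)
    prefix σ = decList L₁ (Vec.take (L₁ * slot) (Vec.drop cw σ))
    sampled σ = decList L₂ (Vec.drop (L₁ * slot) (Vec.drop cw σ))

    counter-enc : ∀ m xs ys → m < 2 ^ cw → counter (enc m xs ys) ≡ m
    counter-enc m xs ys lt = trans (cong fromBits (take-++ (toBits cw m) _)) (fromBits-toBits cw m lt)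

    prefix-enc : ∀ m xs ys → prefix (enc m xs ys) ≡ take L₁ xs
    prefix-enc m xs ys
      rewrite drop-++ (toBits cw m) (encList L₁ xs Vec.++ encList L₂ ys) | take-++ (encList L₁ xs) (encList L₂ ys)
      = decList-encList L₁ xs

    sampled-enc : ∀ m xs ys → sampled (enc m xs ys) ≡ take L₂ ys
    sampled-enc m xs ys
      rewrite drop-++ (toBits cw m) (encList L₁ xs Vec.++ encList L₂ ys) | drop-++ (encList L₁ xs) (encList L₂ ys)
      = decList-encList L₂ ys

    machine : (Bits space → Vec Bool n) → (Vec Bool n → ℕ → List (Edge n) → List (Edge n) → ℚ) → StreamingAlg n space
    machine table out = record
      { init   = λ r → enc 0 [] []
      ; step   = λ r σ e → enc (suc (counter σ)) (prefix σ ++ e ∷ []) (sampled σ ++ sample (table r) (e ∷ []))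
      ; output = λ r σ → out (table r) (counter σ) (prefix σ) (sampled σ)
      }

    module _ (table : Bits space → Vec Bool n) (out : Vec Bool n → ℕ → List (Edge n) → List (Edge n) → ℚ) where

      state : Bits space → List (Edge n) → Bits space
      state r es = enc (length es) es (sample (table r) es)

      step-state : ∀ r es e → length es < 2 ^ cw → step (machine table out) r (state r es) e ≡ state r (es ++ e ∷ [])
      step-state r es e lt
        rewrite counter-enc (length es) es (sample (table r) es) lt
              | prefix-enc (length es) es (sample (table r) es)
              | sampled-enc (length es) es (sample (table r) es)
              | filter-++ (λ e → T? (touches (table r) e)) es (e ∷ [])
              | length-++ es {e ∷ []} | +-comm (length es) 1
        = cong₂ (λ x y → toBits cw (suc (length es)) Vec.++ (x Vec.++ y))
            (encList-take L₁ es (e ∷ [])) (encList-take L₂ (sample (table r) es) (sample (table r) (e ∷ [])))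

      foldl-state : ∀ r ps es → length (ps ++ es) < 2 ^ cw → foldl (step (machine table out) r) (state r ps) es ≡ state r (ps ++ es)
      foldl-state r ps []       lt = cong (state r) (sym (++-identityʳ ps))
      foldl-state r ps (e ∷ es) lt
        rewrite step-state r ps e (≤-<-trans (length-++-≤ˡ ps) lt) =
          trans (foldl-state r (ps ++ e ∷ []) es (subst (λ z → length z < 2 ^ cw) (sym reassoc) lt)) (cong (state r) reassoc)
        where
        reassoc : (ps ++ e ∷ []) ++ es ≡ ps ++ e ∷ es
        reassoc = ++-assoc ps (e ∷ []) es

mutual

  -- The fold inside run is a local function of Defs that cannot be named here; the type of
  -- fold≡foldl refers to it by a placeholder that its use in run≡foldl determines.
  run≡foldl : ∀ {n s} (A : StreamingAlg n s) r es → run A r es ≡ output A r (foldl (step A r) (init A r) es)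
  run≡foldl A r []       = refl
  run≡foldl A r (e ∷ es) with step A r (init A r) e | e ∷ es
  ... | m | all = cong (output A r) (fold≡foldl A r all m es)

  fold≡foldl : ∀ {n s} (A : StreamingAlg n s) r (all : List (Edge n)) m es → _ ≡ foldl (step A r) m es
  fold≡foldl A r all m []       = refl
  fold≡foldl A r all m (e ∷ es) = fold≡foldl A r all (step A r m e) es

-- Comparisons of rational values.

-- x / d, with the junk value 0 at d = 0.
ratio : ℕ → ℕ → ℚ
ratio x zero    = 0ℚ
ratio x (suc d) = ⁺ x / suc d

maxval≡ratio : ∀ {n} (E : List (Edge n)) → maxval E ≡ ratio (maxCutCount E) (length E)
maxval≡ratio E with length E
... | zero  = refl
... | suc m = refl

toℚᵘ-ratio : ∀ x d → toℚᵘ (ratio x (suc d)) ℚᵘ.≃ ℚᵘ.mkℚᵘ (⁺ x) d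
toℚᵘ-ratio x d = ℚ.toℚᵘ-fromℚᵘ (ℚᵘ.mkℚᵘ (⁺ x) d)

ratio-mono : ∀ x d y e .{{_ : NonZero d}} .{{_ : NonZero e}} → x * e ≤ y * d → ratio x d ℚ.≤ ratio y e
ratio-mono x (suc d) y (suc e) le = ℚ.toℚᵘ-cancel-≤
  (ℚᵘ.≤-respˡ-≃ (ℚᵘ.≃-sym (toℚᵘ-ratio x d)) (ℚᵘ.≤-respʳ-≃ (ℚᵘ.≃-sym (toℚᵘ-ratio y e))
    (ℚᵘ.*≤* (subst₂ ℤ._≤_ (ℤ.pos-* x (suc e)) (ℤ.pos-* y (suc d)) (ℤ.+≤+ le)))))

-- A positive ε is at least 1 / F for its denominator F, so 1 / F may replace it. The hypothesis is
-- that case with denominators cleared and the negative term moved to the right.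
½-ε-bound : ∀ (ε : ℚ) → Positive ε → ∀ x d z e .{{_ : NonZero d}} .{{_ : NonZero e}} →
  x * (ℚ.denominatorℕ ε * e) ≤ z * (2 * ℚ.denominatorℕ ε * d) + 2 * x * e →
  (½ ℚ.- ε) ℚ.* ratio x d ℚ.≤ ratio z e
½-ε-bound ε@(mkℚ (+[1+ i ]) f _) pos x (suc d) z (suc e) h = ℚ.toℚᵘ-cancel-≤
  (ℚᵘ.≤-respˡ-≃ (ℚᵘ.≃-sym lhs) (ℚᵘ.≤-respʳ-≃ (ℚᵘ.≃-sym (toℚᵘ-ratio z e)) (ℚᵘ.*≤* cross)))
  where
  lhs : toℚᵘ ((½ ℚ.- ε) ℚ.* ratio x (suc d)) ℚᵘ.≃ (ℚᵘ.½ ℚᵘ.- ℚᵘ.mkℚᵘ +[1+ i ] f) ℚᵘ.* ℚᵘ.mkℚᵘ (⁺ x) d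
  lhs = ℚᵘ.≃-trans (ℚ.toℚᵘ-homo-* (½ ℚ.- ε) (ratio x (suc d)))
    (ℚᵘ.*-cong (ℚᵘ.≃-trans (ℚ.toℚᵘ-homo-+ ½ (ℚ.- ε)) (ℚᵘ.+-congʳ ℚᵘ.½ (ℚ.toℚᵘ-homo‿- ε))) (toℚᵘ-ratio x d))
  F = suc f
  G = suc e
  c : ℕ
  c = 2 * (suc i * (x * G))
  moved : ∀ F i x G → ((⁺ 1 ℤ.* F ℤ.+ (ℤ.- i) ℤ.* ⁺ 2) ℤ.* x) ℤ.* G ℤ.+ ⁺ 2 ℤ.* (i ℤ.* (x ℤ.* G)) ≡ x ℤ.* (F ℤ.* G)
  moved = solve-∀ᶻ
  pos-c : ⁺ c ≡ ⁺ 2 ℤ.* (⁺ suc i ℤ.* (⁺ x ℤ.* ⁺ G))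
  pos-c = trans (ℤ.pos-* 2 (suc i * (x * G))) (cong (⁺ 2 ℤ.*_) (trans (ℤ.pos-* (suc i) (x * G)) (cong (⁺ suc i ℤ.*_) (ℤ.pos-* x G))))
  pos-x : x * (F * G) ≤ z * (2 * F * suc d) + c
  pos-x = ≤-trans h (+-monoʳ-≤ _ (≤-trans (≤-reflexive (*-assoc 2 x G)) (*-monoʳ-≤ 2 (m≤n*m (x * G) (suc i)))))
  add-sub : ∀ a c → a ℤ.+ c ℤ.+ (ℤ.- c) ≡ a
  add-sub = solve-∀ᶻ
  cancel : ∀ c {a b} → a ℤ.+ c ℤ.≤ b ℤ.+ c → a ℤ.≤ b
  cancel c {a} {b} le = subst₂ ℤ._≤_ (add-sub a c) (add-sub b c) (ℤ.+-monoˡ-≤ (ℤ.- c) le)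
  left = ((⁺ 1 ℤ.* ⁺ F ℤ.+ (ℤ.- ⁺ suc i) ℤ.* ⁺ 2) ℤ.* ⁺ x) ℤ.* ⁺ G
  cross : left ℤ.≤ ⁺ z ℤ.* ⁺ (2 * F * suc d)
  cross = cancel (⁺ c) (subst₂ ℤ._≤_
    (trans (trans (ℤ.pos-* x (F * G)) (cong (⁺ x ℤ.*_) (ℤ.pos-* F G)))
      (trans (sym (moved (⁺ F) (⁺ suc i) (⁺ x) (⁺ G))) (cong (λ t → left ℤ.+ t) (sym pos-c))))
    (cong (λ t → t ℤ.+ ⁺ c) (ℤ.pos-* z (2 * F * suc d)))
    (ℤ.+≤+ pos-x))

½-ε≤1 : ∀ (ε : ℚ) → Positive ε → ∀ x d → (½ ℚ.- ε) ℚ.* ratio x d ℚ.≤ ratio x d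
½-ε≤1 ε pos x zero    = ℚ.≤-reflexive (ℚ.*-zeroʳ (½ ℚ.- ε))
½-ε≤1 ε pos x (suc d) = ½-ε-bound ε pos x (suc d) x (suc d)
  (≤-trans (*-monoʳ-≤ x (*-monoˡ-≤ (suc d) (m≤m+n F (F + 0)))) (m≤m+n _ (2 * x * suc d)))
  where F = ℚ.denominatorℕ ε

-- Integer roots and the accuracy of the output.

^-distrib-* : ∀ m n o → (m * n) ^ o ≡ m ^ o * n ^ o
^-distrib-* m n zero    = refl
^-distrib-* m n (suc o) = trans (cong (m * n *_) (^-distrib-* m n o)) (shuffle m n (m ^ o) (n ^ o))
  where
  shuffle : ∀ m n x y → m * n * (x * y) ≡ m * x * (n * y)
  shuffle = solve-∀

n<2^n : ∀ n → n < 2 ^ n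
n<2^n zero    = s≤s z≤n
n<2^n (suc n) = ≤-trans (s≤s (n<2^n n)) (≤-trans (+-monoˡ-≤ (2 ^ n) (m^n>0 2 n)) (≤-reflexive (cong (2 ^ n +_) (sym (+-identityʳ (2 ^ n))))))

-- For n ≥ 1, 2^j is the R-th root of n up to a factor of 2; `j` grows by one whenever n outgrows
-- 2^(R * suc j). The `⊔ 1` covers n = 0.
level : ∀ R .{{_ : NonZero R}} n → ∃ λ j → (suc n ≤ 2 ^ (R * suc j)) × (2 ^ (R * j) ≤ n ⊔ 1)
level R zero = 0 , m^n>0 2 (R * 1) , ≤-reflexive (cong (2 ^_) (*-zeroʳ R))
level R (suc n) with level R n
... | j , above , below with suc (suc n) ≤? 2 ^ (R * suc j)
... | yes le = j , le , ≤-trans below (⊔-monoˡ-≤ 1 (n≤1+n n))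
... | no gt  = suc j , (begin
  suc (suc n)                     ≤⟨ s≤s above ⟩
  1 + X                           ≤⟨ +-monoˡ-≤ X (m^n>0 2 (R * suc j)) ⟩
  X + X                           ≡⟨ cong (X +_) (+-identityʳ X) ⟨
  2 ^ (1 + R * suc j)             ≤⟨ ^-monoʳ-≤ 2 (+-monoˡ-≤ (R * suc j) (>-nonZero⁻¹ R)) ⟩
  2 ^ (R + R * suc j)             ≡⟨ cong (2 ^_) (*-suc R (suc j)) ⟨
  2 ^ (R * suc (suc j))           ∎) , ≤-trans (s≤s⁻¹ (≰⇒> gt)) (m≤m⊔n (suc n) 1)
  where
  open ≤-Reasoning
  X = 2 ^ (R * suc j)

length-allBits : ∀ s → count (λ _ → true) (allBits s) ≡ 2 ^ s
length-allBits zero    = refl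
length-allBits (suc s) = trans (count-allBits s (λ _ → true))
  (cong₂ _+_ (length-allBits s) (trans (length-allBits s) (sym (+-identityʳ (2 ^ s)))))

module Accuracy {m mc Z Φ K T D ed : ℕ} .{{_ : NonZero m}} .{{_ : NonZero (T * (2 * K))}}
  (close : ∣ Z - Φ ∣ ≤ m) (Φ≤ : Φ ≤ T * (2 * K * mc)) (≤Φ : T * (K * mc) ≤ Φ + m * (K * K + T * D))
  (m≤4mc : m ≤ 4 * mc) (params : 2 * ed * (K * K + T * D + 2) ≤ K * T) where

  private
    P = T * (2 * K)
    instance
      P*m≢0 : NonZero (P * m)
      P*m≢0 = m*n≢0 P m

  Z∸m≤Φ : Z ∸ m ≤ Φ
  Z∸m≤Φ = ≤-trans (∸-monoˡ-≤ m (≤-trans (m≤∣m-n∣+n Z Φ) (+-monoˡ-≤ Φ close))) (≤-reflexive (m+n∸m≡n m Φ))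

  Φ≤Z∸m : Φ ≤ Z ∸ m + 2 * m
  Φ≤Z∸m = begin
    Φ                 ≤⟨ m≤∣m-n∣+n Φ Z ⟩
    ∣ Φ - Z ∣ + Z     ≡⟨ cong (_+ Z) (∣-∣-comm Φ Z) ⟩
    ∣ Z - Φ ∣ + Z     ≤⟨ +-monoˡ-≤ Z close ⟩
    m + Z             ≤⟨ +-monoʳ-≤ m (m≤n+m∸n Z m) ⟩
    m + (m + (Z ∸ m)) ≡⟨ shuffle m (Z ∸ m) ⟩
    Z ∸ m + 2 * m     ∎
    where
    open ≤-Reasoning
    shuffle : ∀ m z → m + (m + z) ≡ z + 2 * m
    shuffle = solve-∀

  -- The output may never exceed the optimum, so the estimate is shifted down by its possible error
  -- `m` before dividing.
  upper : ratio (Z ∸ m) (P * m) ℚ.≤ ratio mc m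
  upper = ratio-mono (Z ∸ m) (P * m) mc m (begin
    (Z ∸ m) * m            ≤⟨ *-monoˡ-≤ m (≤-trans Z∸m≤Φ Φ≤) ⟩
    T * (2 * K * mc) * m   ≡⟨ shuffle T K mc m ⟩
    mc * (P * m)           ∎)
    where
    open ≤-Reasoning
    shuffle : ∀ t k c m → t * (2 * k * c) * m ≡ c * (t * (2 * k) * m)
    shuffle = solve-∀

  -- The loss per edge is K K + T D from the ascent and 2 from sampling and shift together. `m≤4mc`
  -- and `params` turn it into the 1 / ed share of the optimum that `½-ε-bound` allows.
  lower : ∀ ε → Positive ε → ℚ.denominatorℕ ε ≡ ed → (½ ℚ.- ε) ℚ.* ratio mc m ℚ.≤ ratio (Z ∸ m) (P * m)
  lower ε pos refl = ½-ε-bound ε pos mc m (Z ∸ m) (P * m) (begin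
    mc * (ed * (T * (2 * K) * m))                      ≡⟨ shuffle₁ mc ed T K m ⟩
    2 * ed * (T * (K * mc)) * m                        ≤⟨ *-monoˡ-≤ m (*-monoʳ-≤ (2 * ed) (≤-trans ≤Φ (+-monoˡ-≤ _ Φ≤Z∸m))) ⟩
    2 * ed * (z + 2 * m + m * X) * m                   ≡⟨ shuffle₂ ed z m X ⟩
    z * (2 * ed * m) + 2 * ed * (X + 2) * m * m        ≤⟨ +-monoʳ-≤ (z * (2 * ed * m)) (*-monoˡ-≤ m (*-mono-≤ params m≤4mc)) ⟩
    z * (2 * ed * m) + K * T * (4 * mc) * m            ≡⟨ cong (z * (2 * ed * m) +_) (shuffle₃ K T mc m) ⟩
    z * (2 * ed * m) + 2 * mc * (T * (2 * K) * m)      ∎)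
    where
    open ≤-Reasoning
    X = K * K + T * D
    z = Z ∸ m
    shuffle₁ : ∀ c e t k m → c * (e * (t * (2 * k) * m)) ≡ 2 * e * (t * (k * c)) * m
    shuffle₁ = solve-∀
    shuffle₂ : ∀ e z m x → 2 * e * (z + 2 * m + m * x) * m ≡ z * (2 * e * m) + 2 * e * (x + 2) * m * m
    shuffle₂ = solve-∀
    shuffle₃ : ∀ k t c m → k * t * (4 * c) * m ≡ 2 * c * (t * (2 * k) * m)
    shuffle₃ = solve-∀

count-cover : {A : Set} (p q : A → Bool) → (∀ x → q x ≡ false → p x ≡ true) →
  ∀ xs → count (λ _ → true) xs ≤ count p xs + count q xs
count-cover p q h []       = z≤n
count-cover p q h (x ∷ xs) = ≤-trans (+-mono-≤ covered (count-cover p q h xs)) (≤-reflexive (shuffle ⟦ p x ⟧ ⟦ q x ⟧ _ _))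
  where
  shuffle : ∀ a b c d → a + b + (c + d) ≡ a + c + (b + d)
  shuffle = solve-∀
  covered : 1 ≤ ⟦ p x ⟧ + ⟦ q x ⟧
  covered with q x in eq
  ... | true  = m≤n+m 1 ⟦ p x ⟧
  ... | false rewrite h x eq = ≤-refl

most-good : ∀ N g c a → 200 ≤ a → N ≤ g + c → a * c ≤ 2 * N → 99 * N ≤ 100 * g
most-good N g c a a≥200 covered few = +-cancelʳ-≤ N (99 * N) (100 * g) (begin
  99 * N + N          ≡⟨ +-comm (99 * N) N ⟩
  100 * N             ≤⟨ *-monoʳ-≤ 100 covered ⟩
  100 * (g + c)       ≡⟨ *-distribˡ-+ 100 g c ⟩
  100 * g + 100 * c   ≤⟨ +-monoʳ-≤ (100 * g) (*-cancelˡ-≤ 2 (≤-trans (≤-reflexive (sym (*-assoc 2 100 c))) (≤-trans (*-monoˡ-≤ c a≥200) few))) ⟩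
  100 * g + N         ∎)
  where open ≤-Reasoning

⌊⌋-true : {P : Set} (P? : Dec P) → P → ⌊ P? ⌋ ≡ true
⌊⌋-true (yes _) p = refl
⌊⌋-true (no ¬p) p = ⊥-elim (¬p p)

approximates : ∀ {n} α (E : List (Edge n)) o →
  α ℚ.* ratio (maxCutCount E) (length E) ℚ.≤ o → o ℚ.≤ ratio (maxCutCount E) (length E) → Approximates α E o
approximates α E o lo hi = subst (λ v → (α ℚ.* v ℚ.≤ o) × (o ℚ.≤ v)) (sym (maxval≡ratio E)) (lo , hi)

if-≤ : {A : Set} {x y : A} {m L : ℕ} → m ≤ L → (if ⌊ m ≤? L ⌋ then x else y) ≡ x
if-≤ {m = m} {L} le with m ≤? L
... | yes _ = refl
... | no gt = ⊥-elim (gt le)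

if-≰ : {A : Set} {x y : A} {m L : ℕ} → ¬ (m ≤ L) → (if ⌊ m ≤? L ⌋ then x else y) ≡ y
if-≰ {m = m} {L} gt with m ≤? L
... | yes le = ⊥-elim (gt le)
... | no _   = refl

-- The algorithm for a fixed number of vertices.

-- cw bits count the edges, w bits name a vertex, L₁ is the length of the stored prefix,
-- and 1 / suc b is the sampling probability.
record Sizes (D K T a n Y : ℕ) : Set where
  field
    b w cw L₁ cap : ℕ
    n≤2^w         : n ≤ 2 ^ w
    short         : n * D < 2 ^ cw
    few           : (1 + n * n) ^ (n * D) ≤ 2 ^ (2 ^ cw)
    cap-large     : 2 * 2 ^ a * suc n ≤ suc b * cap
    L₁-large      : 2 * 2 ^ a * Estimator.noise {n} D K T b ≤ L₁
    space≤        : cw + (L₁ * suc (w + w) + D * cap * suc (w + w)) ≤ Y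

module Algorithm (D K T a : ℕ) .{{_ : NonZero K}} {n Y : ℕ} (sizes : Sizes D K T a n Y) where

  open Sizes sizes

  L₂ : ℕ
  L₂ = D * cap

  open Estimator {n} D K T b
  open Codec {n} w n≤2^w
  open Machine cw L₁ L₂ public

  -- Newman's argument needs finitely many inputs; the degree bound limits the length to n * D, so
  -- every valid stream is listed.
  inputs : List (List (Edge n))
  inputs = filter (valid? D) (streams n (n * D))

  few-inputs : length inputs ≤ 2 ^ (2 ^ space)
  few-inputs = begin
    length inputs                    ≤⟨ length-filter (valid? D) (streams n (n * D)) ⟩
    length (streams n (n * D))       ≤⟨ length-streams n (n * D) ⟩
    (1 + n * n) ^ (n * D)            ≤⟨ few ⟩
    2 ^ (2 ^ cw)                     ≤⟨ ^-monoʳ-≤ 2 (^-monoʳ-≤ 2 (m≤m+n cw (L₁ * slot + L₂ * slot))) ⟩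
    2 ^ (2 ^ space)                  ∎
    where open ≤-Reasoning

  spoils : List (Edge n) → Vec Bool n → Bool
  spoils = bad L₁ cap

  -- In the model the seed is as long as the memory, so the table has one entry for each of the
  -- 2^space seeds and a uniform seed draws a uniform entry.
  chosen : ∃ λ (table : Bits space → Vec Bool n) →
    ∀ {E} → E ∈ inputs → a * count (spoils E ∘ table) (allBits space) ≤ 2 * 2 ^ space
  chosen = Newman.newman inputs b a spoils
    (λ {E} E∈ → bad-rare (2 ^ a) L₁ cap cap-large L₁-large E (proj₂ (∈-filter⁻ (valid? D) {xs = streams n (n * D)} E∈)))
    space few-inputs

  table : Bits space → Vec Bool n
  table = proj₁ chosen

  -- There are `suc T` iterates, each of relaxed value at most 2 K times the optimal cut.
  P : ℕ
  P = suc T * (2 * K)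

  out : Vec Bool n → ℕ → List (Edge n) → List (Edge n) → ℚ
  out S m xs ys = if ⌊ m ≤? L₁ ⌋ then maxval xs else ratio (estimator S ys ∸ m) (P * m)

  algorithm : StreamingAlg n space
  algorithm = machine table out

  module _ (E : List (Edge n)) (val : Valid D E) where

    length<2^cw : length E < 2 ^ cw
    length<2^cw = ≤-<-trans (length≤n*D E (proj₂ val)) short

    run-algorithm : ∀ r → run algorithm r E ≡ out (table r) (length E) (take L₁ E) (take L₂ (sample (table r) E))
    run-algorithm r = begin
      run algorithm r E                                        ≡⟨ run≡foldl algorithm r E ⟩
      output algorithm r (foldl (step algorithm r) (state table out r []) E) ≡⟨ cong (output algorithm r) (foldl-state table out r [] E length<2^cw) ⟩
      output algorithm r (enc m E E′)                          ≡⟨ cong₂ (λ x y → out (table r) x y (sampled (enc m E E′))) (counter-enc m E E′ length<2^cw) (prefix-enc m E E′) ⟩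
      out (table r) m (take L₁ E) (sampled (enc m E E′))       ≡⟨ cong (out (table r) m (take L₁ E)) (sampled-enc m E E′) ⟩
      out (table r) m (take L₁ E) (take L₂ E′)                 ∎
      where
      open ≡-Reasoning
      m = length E
      E′ = sample (table r) E

    module _ (ε : ℚ) (pos : Positive ε)
      (params : 2 * ℚ.denominatorℕ ε * (K * K + suc T * D + 2) ≤ K * suc T) where

      α : ℚ
      α = ½ ℚ.- ε

      small : ∀ o → o ≡ maxval E → Approximates α E o
      small o refl = approximates α E o
        (subst (α ℚ.* ratio (maxCutCount E) (length E) ℚ.≤_) (sym (maxval≡ratio E)) (½-ε≤1 ε pos (maxCutCount E) (length E)))
        (ℚ.≤-reflexive (maxval≡ratio E))

      module _ (r : Bits space) (ok : spoils E (table r) ≡ false) where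

        S : Vec Bool n
        S = table r

        m : ℕ
        m = length E

        fits = proj₁ (bad-false L₁ cap E S ok)
        near = proj₂ (bad-false L₁ cap E S ok)

        sample-kept : take L₂ (sample S E) ≡ sample S E
        sample-kept = take-all L₂ (sample S E) (≤-trans (length-sample S E (proj₂ val)) (*-monoʳ-≤ D fits))

        large : L₁ < m → Approximates α E (ratio (estimator S E ∸ m) (P * m))
        large L₁<m = approximates α E _ (lower ε pos refl) upper
          where
          instance
            m≢0 : NonZero m
            m≢0 = >-nonZero (≤-trans (s≤s z≤n) L₁<m)
            P≢0 : NonZero P
            P≢0 = m*n≢0 (suc T) (2 * K) {{_}} {{m*n≢0 2 K}}
          open Accuracy {m} {maxCutCount E} {estimator S E} {Φ E} {K} {suc T} {D} {ℚ.denominatorℕ ε}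
            (near L₁<m) (Ascent.φ-upper K E (proj₁ val) (suc T)) (Ascent.φ-lower K E (proj₂ val) (suc T))
            (length≤4*max E (proj₁ val)) params

        out-approximates : Dec (m ≤ L₁) → Approximates α E (out S m (take L₁ E) (take L₂ (sample S E)))
        out-approximates (yes m≤L₁) = small _ (trans (if-≤ m≤L₁) (cong maxval (take-all L₁ E m≤L₁)))
        out-approximates (no m≰L₁)  = subst (Approximates α E)
          (sym (trans (if-≰ m≰L₁) (cong (λ z → ratio (z ∸ m) (P * m)) (trans (cong (estimator S) sample-kept) (estimator-sample S E)))))
          (large (≰⇒> m≰L₁))

        accurate : Approximates α E (run algorithm r E)
        accurate = subst (Approximates α E) (sym (run-algorithm r)) (out-approximates (m ≤? L₁))

      succeeds : 200 ≤ a → SucceedsWhp algorithm α E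
      succeeds a≥200 = most-good (2 ^ space) (goodSeeds algorithm α E) spoiled a a≥200 covered (proj₂ chosen E∈inputs)
        where
        spoiled : ℕ
        spoiled = count (spoils E ∘ table) (allBits space)
        E∈inputs : E ∈ inputs
        E∈inputs = ∈-filter⁺ (valid? D) (streams-complete (n * D) E (length≤n*D E (proj₂ val))) val
        covered : 2 ^ space ≤ goodSeeds algorithm α E + spoiled
        covered = ≤-trans (≤-reflexive (sym (length-allBits space)))
          (count-cover (λ r → ⌊ approximates? α E (run algorithm r E) ⌋) (spoils E ∘ table)
            (λ r ok → ⌊⌋-true (approximates? α E (run algorithm r E)) (accurate r ok)) (allBits space))

  algorithm-exists : 200 ≤ a → ∀ ε → Positive ε →
    2 * ℚ.denominatorℕ ε * (K * K + suc T * D + 2) ≤ K * suc T →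
    ∃ λ s → (s ≤ Y) × Σ (StreamingAlg n s) λ A → ∀ E → Valid D E → SucceedsWhp A (½ ℚ.- ε) E
  algorithm-exists a≥200 ε pos params =
    space , space≤ , algorithm , λ E val → succeeds E val ε pos params a≥200

-- Choice of the parameters and the space exponent.

-- Expresses a space bound of order n^(r / (r + 1)) by integer powers, with B in the role of n^(1 /
-- (r + 1)).
power-bound : ∀ s C B r n → s ≤ C * B ^ r → B ^ suc r ≤ n → s ^ suc r ≤ C ^ suc r * n ^ r
power-bound s C B r n s≤ ≤n = begin
  s ^ suc r                      ≤⟨ ^-monoˡ-≤ (suc r) s≤ ⟩
  (C * B ^ r) ^ suc r            ≡⟨ ^-distrib-* C (B ^ r) (suc r) ⟩
  C ^ suc r * (B ^ r) ^ suc r    ≡⟨ cong (C ^ suc r *_) (trans (^-*-assoc B r (suc r)) (trans (cong (B ^_) (*-comm r (suc r))) (sym (^-*-assoc B (suc r) r)))) ⟩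
  C ^ suc r * (B ^ suc r) ^ r    ≤⟨ *-monoʳ-≤ (C ^ suc r) (^-monoˡ-≤ r ≤n) ⟩
  C ^ suc r * n ^ r              ∎
  where open ≤-Reasoning

level-power : ∀ R j n → 1 ≤ n → 2 ^ (R * j) ≤ n ⊔ 1 → (2 ^ j) ^ R ≤ n
level-power R j n n≥1 le = begin
  (2 ^ j) ^ R    ≡⟨ ^-*-assoc 2 j R ⟩
  2 ^ (j * R)    ≡⟨ cong (2 ^_) (*-comm j R) ⟩
  2 ^ (R * j)    ≤⟨ le ⟩
  n ⊔ 1          ≡⟨ m≥n⇒m⊔n≡m n≥1 ⟩
  n              ∎
  where open ≤-Reasoning

-- An algorithm for n-vertex inputs whose space is at most C n^(r/(r+1)).
Sublinear : (D : ℕ) (α : ℚ) (C r n : ℕ) → Set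
Sublinear D α C r n = ∃ λ s → (1 ≤ n → s ^ suc r ≤ C * n ^ r) ×
  Σ (StreamingAlg n s) λ A → ∀ E → Valid D E → SucceedsWhp A α E

sublinear : ∀ D α C r n B → (1 ≤ n → B ^ suc r ≤ n) →
  (∃ λ s → (s ≤ C * B ^ r) × Σ (StreamingAlg n s) λ A → ∀ E → Valid D E → SucceedsWhp A α E) →
  Sublinear D α (C ^ suc r) r n
sublinear D α C r n B B≤ (s , s≤ , rest) = s , (λ n≥1 → power-bound s C B r n s≤ (B≤ n≥1)) , rest

package : ∀ D ε C r → (∀ n → Sublinear D (½ - ε) C r n) →
    Σ ℕ λ q → Σ ℕ λ C → Σ ℕ λ N → Σ (ℕ → ℕ) λ s →
    Σ ((n : ℕ) → StreamingAlg n (s n)) λ A →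
    (1 ≤ q)
    × (∀ n → N ≤ n → s n ^ q ≤ C * n ^ (q ∸ 1))
    × (∀ n (E : List (Edge n)) → NoLoops E → MaxDegreeAtMost D E →
    SucceedsWhp (A n) (½ - ε) E)
package D ε C r family = suc r , C , 1 , (λ n → proj₁ (family n)) , (λ n → proj₁ (proj₂ (proj₂ (family n)))) ,
  s≤s z≤n , (λ n → proj₁ (proj₂ (family n))) ,
  λ n E nl md → proj₂ (proj₂ (proj₂ (family n))) E (nl , λ v → ≤-trans (≤-reflexive (sym (degree≡deg E nl v))) (md v))

module Construction (D K T a : ℕ) .{{_ : NonZero K}} where

  -- With B = 2^j about n^(1/R), the sampling rate is 1 / B²: this leaves about B^(R - 2) = B^(1 + 2
  -- k) vertices, and the extra factor B pays for the at most 3 R B bits per stored edge, giving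
  -- B^(R - 1) in total. The prefix of order (B²)^k edges fits as well. The factor 2^R in `c₂`
  -- absorbs the gap between n and the power of two above it.
  k R A c₁ c₂ : ℕ
  k = 2 * ballSize D (suc T)
  R = 3 + 2 * k
  A = 2 ^ a
  c₁ = 2 * A * (suc T * K * (suc T * K) * (k * (D * ballSize D (suc T))))
  c₂ = 2 * A * 2 ^ R

  module At (n j : ℕ) (n< : suc n ≤ 2 ^ (R * suc j)) where

    B b w cap L₁ cw : ℕ
    B = 2 ^ j
    b = pred (B * B)
    w = R * suc j
    cap = c₂ * B ^ (1 + 2 * k)
    L₁ = c₁ * (B * B) ^ k
    -- There are at most 2^(2 w n D) streams, and 2 w n D is at most 2^(2 w) 2^w 2^D = 2^cw.
    cw = 2 * w + (w + D)

    suc-b : suc b ≡ B * B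
    suc-b = suc-pred (B * B) {{m*n≢0 B B {{m^n≢0 2 j}} {{m^n≢0 2 j}}}}

    noise = Estimator.noise {n} D K T b

    cap-large : 2 * A * suc n ≤ suc b * cap
    cap-large = begin
      2 * A * suc n                          ≤⟨ *-monoʳ-≤ (2 * A) n< ⟩
      2 * A * 2 ^ (R * suc j)                ≡⟨ cong (λ z → 2 * A * 2 ^ z) (*-suc R j) ⟩
      2 * A * 2 ^ (R + R * j)                ≡⟨ cong (2 * A *_) (^-distribˡ-+-* 2 R (R * j)) ⟩
      2 * A * (2 ^ R * 2 ^ (R * j))          ≡⟨ cong (λ z → 2 * A * (2 ^ R * 2 ^ z)) (*-comm R j) ⟩
      2 * A * (2 ^ R * 2 ^ (j * R))          ≡⟨ cong (λ z → 2 * A * (2 ^ R * z)) (^-*-assoc 2 j R) ⟨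
      2 * A * (2 ^ R * (B * (B * B ^ (1 + 2 * k)))) ≡⟨ shuffle (2 * A) (2 ^ R) B (B ^ (1 + 2 * k)) ⟩
      B * B * cap                            ≡⟨ cong (_* cap) suc-b ⟨
      suc b * cap                            ∎
      where
      open ≤-Reasoning
      shuffle : ∀ a r b x → a * (r * (b * (b * x))) ≡ b * b * (a * r * x)
      shuffle = solve-∀

    L₁-large : 2 * A * noise ≤ L₁
    L₁-large = ≤-reflexive (trans (cong (λ z → 2 * A * (suc T * K * (suc T * K) * (z ^ k * (k * (D * ballSize D (suc T)))))) suc-b)
      (shuffle (2 * A) (suc T * K * (suc T * K)) ((B * B) ^ k) (k * (D * ballSize D (suc T)))))
      where
      shuffle : ∀ a c q h → a * (c * (q * h)) ≡ a * (c * h) * q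
      shuffle = solve-∀

    D≤2^D : D ≤ 2 ^ D
    D≤2^D = <⇒≤ (n<2^n D)

    few : (1 + n * n) ^ (n * D) ≤ 2 ^ (2 ^ cw)
    few = begin
      (1 + n * n) ^ (n * D)            ≤⟨ ^-monoˡ-≤ (n * D) edges≤ ⟩
      (2 ^ (2 * w)) ^ (n * D)          ≡⟨ ^-*-assoc 2 (2 * w) (n * D) ⟩
      2 ^ (2 * w * (n * D))            ≤⟨ ^-monoʳ-≤ 2 (*-mono-≤ (<⇒≤ (n<2^n (2 * w))) (*-mono-≤ (<⇒≤ n<) D≤2^D)) ⟩
      2 ^ (2 ^ (2 * w) * (2 ^ w * 2 ^ D)) ≡⟨ cong (2 ^_) (trans (cong (2 ^ (2 * w) *_) (sym (^-distribˡ-+-* 2 w D))) (sym (^-distribˡ-+-* 2 (2 * w) (w + D)))) ⟩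
      2 ^ (2 ^ cw)                     ∎
      where
      open ≤-Reasoning
      expand : ∀ n → 1 + n * n + 2 * n ≡ (1 + n) * (1 + n)
      expand = solve-∀
      edges≤ : 1 + n * n ≤ 2 ^ (2 * w)
      edges≤ = begin
        1 + n * n               ≤⟨ m≤m+n _ (2 * n) ⟩
        1 + n * n + 2 * n       ≡⟨ expand n ⟩
        suc n * suc n           ≤⟨ *-mono-≤ n< n< ⟩
        2 ^ w * 2 ^ w           ≡⟨ ^-distribˡ-+-* 2 w w ⟨
        2 ^ (w + w)             ≡⟨ cong (λ z → 2 ^ (w + z)) (+-identityʳ w) ⟨
        2 ^ (2 * w)             ∎

    short : n * D < 2 ^ cw
    short = begin
      suc (n * D)         ≤⟨ s≤s (*-monoʳ-≤ n D≤2^D) ⟩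
      suc (n * 2 ^ D)     ≤⟨ +-monoˡ-≤ (n * 2 ^ D) (m^n>0 2 D) ⟩
      suc n * 2 ^ D       ≤⟨ *-monoˡ-≤ (2 ^ D) n< ⟩
      2 ^ w * 2 ^ D       ≡⟨ ^-distribˡ-+-* 2 w D ⟨
      2 ^ (w + D)         ≤⟨ ^-monoʳ-≤ 2 (m≤n+m (w + D) (2 * w)) ⟩
      2 ^ cw              ∎
      where open ≤-Reasoning

    slot : ℕ
    slot = suc (w + w)

    space≤ : cw + (L₁ * slot + D * cap * slot) ≤ (3 * R + D + (c₁ + D * c₂) * (3 * R)) * B ^ (2 + 2 * k)
    space≤ = begin
      cw + (L₁ * slot + D * cap * slot)
        ≤⟨ +-mono-≤ cw≤ (+-mono-≤ (*-mono-≤ (≤-reflexive (cong (c₁ *_) power)) slot≤) (*-monoʳ-≤ (D * cap) slot≤)) ⟩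
      (3 * R + D) * B + (c₁ * X * (3 * (R * B)) + D * (c₂ * (B * X)) * (3 * (R * B)))
        ≤⟨ +-mono-≤ (*-monoʳ-≤ (3 * R + D) (m≤m*n B (B * X))) (+-monoˡ-≤ _ (*-monoʳ-≤ (c₁ * X) (*-monoʳ-≤ 3 (*-monoʳ-≤ R (m≤m*n B B))))) ⟩
      (3 * R + D) * (B * (B * X)) + (c₁ * X * (3 * (R * (B * B))) + D * (c₂ * (B * X)) * (3 * (R * B)))
        ≡⟨ shuffle R D c₁ c₂ B X ⟩
      (3 * R + D + (c₁ + D * c₂) * (3 * R)) * (B * (B * X)) ∎
      where
      open ≤-Reasoning
      X = B ^ (2 * k)
      instance
        B≢0 : NonZero B
        B≢0 = m^n≢0 2 j
        X≢0 : NonZero X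
        X≢0 = m^n≢0 B (2 * k)
        BX≢0 : NonZero (B * X)
        BX≢0 = m*n≢0 B X
      shuffle : ∀ r d c e b x → (3 * r + d) * (b * (b * x)) + (c * x * (3 * (r * (b * b))) + d * (e * (b * x)) * (3 * (r * b)))
        ≡ (3 * r + d + (c + d * e) * (3 * r)) * (b * (b * x))
      shuffle = solve-∀
      power : (B * B) ^ k ≡ X
      power = trans (cong (λ z → (B * z) ^ k) (sym (*-identityʳ B))) (^-*-assoc B 2 k)
      w≤ : w ≤ R * B
      w≤ = *-monoʳ-≤ R (n<2^n j)
      cw≤ : cw ≤ (3 * R + D) * B
      cw≤ = begin
        2 * w + (w + D)             ≤⟨ +-mono-≤ (*-monoʳ-≤ 2 w≤) (+-mono-≤ w≤ (m≤m*n D B)) ⟩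
        2 * (R * B) + (R * B + D * B) ≡⟨ collect R D B ⟩
        (3 * R + D) * B             ∎
        where
        collect : ∀ r d b → 2 * (r * b) + (r * b + d * b) ≡ (3 * r + d) * b
        collect = solve-∀
      slot≤ : slot ≤ 3 * (R * B)
      slot≤ = begin
        1 + (w + w)                   ≤⟨ +-mono-≤ (>-nonZero⁻¹ (R * B) {{m*n≢0 R B}}) (+-mono-≤ w≤ w≤) ⟩
        R * B + (R * B + R * B)       ≡⟨ cong (λ z → R * B + (R * B + z)) (+-identityʳ (R * B)) ⟨
        3 * (R * B)                   ∎

  abstract

    C : ℕ
    C = 3 * R + D + (c₁ + D * c₂) * (3 * R)

    sizes : ∀ n j → suc n ≤ 2 ^ (R * suc j) → Sizes D K T a n (C * (2 ^ j) ^ (2 + 2 * k))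
    sizes n j n< = record
      { b = b ; w = w ; cw = cw ; L₁ = L₁ ; cap = cap ; n≤2^w = <⇒≤ n< ; short = short ; few = few
      ; cap-large = cap-large ; L₁-large = L₁-large ; space≤ = space≤ }
      where open At n j n<

  family : 200 ≤ a → ∀ ε → Positive ε → 2 * ℚ.denominatorℕ ε * (K * K + suc T * D + 2) ≤ K * suc T →
    ∀ n → Sublinear D (½ - ε) (C ^ suc (2 + 2 * k)) (2 + 2 * k) n
  family a≥200 ε pos params n = sublinear D (½ - ε) C (2 + 2 * k) n (2 ^ j)
    (λ n≥1 → level-power R j n n≥1 (proj₂ (proj₂ (level R n))))
    (Algorithm.algorithm-exists D K T a (sizes n j (proj₁ (proj₂ (level R n)))) a≥200 ε pos params)
    where
    j : ℕ
    j = proj₁ (level R n)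

-- After division by K and the number of rounds T, the three errors are K / T, D / K and 2 / (K T),
-- and each gets a third of 1 / (2 ed). `K` is fixed first to control D / K, then the number of
-- rounds to control K / T; the last error is then small as well.
ascent-parameters : ∀ ed D .{{_ : NonZero ed}} →
  ∃ λ K → ∃ λ T → NonZero K × (2 * ed * (K * K + suc T * D + 2) ≤ K * suc T)
ascent-parameters ed D = K , 6 * ed * K , K≢0 , *-cancelˡ-≤ 3 (begin
  3 * (2 * ed * (K * K + T * D + 2))              ≡⟨ split ed K T D ⟩
  6 * ed * K * K + 6 * ed * D * T + 6 * ed * 2    ≤⟨ +-mono-≤ (+-mono-≤ (*-monoˡ-≤ K (n≤1+n (6 * ed * K))) (*-monoˡ-≤ T (*-monoʳ-≤ (6 * ed) (n≤1+n D)))) (*-mono-≤ (m≤m*n (6 * ed) (suc D)) (s≤s (>-nonZero⁻¹ (6 * ed * K)))) ⟩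
  T * K + K * T + K * T                           ≡⟨ collect T K ⟩
  3 * (K * T)                                     ∎)
  where
  open ≤-Reasoning
  K = 6 * ed * suc D
  T = suc (6 * ed * K)
  instance
    6ed≢0 : NonZero (6 * ed)
    6ed≢0 = m*n≢0 6 ed
    K≢0 : NonZero K
    K≢0 = m*n≢0 (6 * ed) (suc D)
    6edK≢0 : NonZero (6 * ed * K)
    6edK≢0 = m*n≢0 (6 * ed) K
  split : ∀ e k t d → 3 * (2 * e * (k * k + t * d + 2)) ≡ 6 * e * k * k + 6 * e * d * t + 6 * e * 2
  split = solve-∀
  collect : ∀ t k → t * k + k * t + k * t ≡ 3 * (k * t)
  collect = solve-∀

streaming-for : ∀ D a → 200 ≤ a → ∀ ε → Positive ε →
    (∃ λ K → ∃ λ T → NonZero K × (2 * ℚ.denominatorℕ ε * (K * K + suc T * D + 2) ≤ K * suc T)) →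
    Σ ℕ λ q → Σ ℕ λ C → Σ ℕ λ N → Σ (ℕ → ℕ) λ s →
    Σ ((n : ℕ) → StreamingAlg n (s n)) λ A →
    (1 ≤ q)
    × (∀ n → N ≤ n → s n ^ q ≤ C * n ^ (q ∸ 1))
    × (∀ n (E : List (Edge n)) → NoLoops E → MaxDegreeAtMost D E →
    SucceedsWhp (A n) (½ - ε) E)
streaming-for D a a≥200 ε pos (K , T , K≢0 , params) = package D ε (C ^ suc (2 + 2 * k)) (2 + 2 * k) (family a≥200 ε pos params)
  where open Construction D K T a {{K≢0}}

theorem1p1 : (D : ℕ) (ε : ℚ) → Positive ε →
    Σ ℕ λ q → Σ ℕ λ C → Σ ℕ λ N → Σ (ℕ → ℕ) λ s →
    Σ ((n : ℕ) → StreamingAlg n (s n)) λ A →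
    (1 ≤ q)
    × (∀ n → N ≤ n → s n ^ q ≤ C * n ^ (q ∸ 1))
    × (∀ n (E : List (Edge n)) → NoLoops E → MaxDegreeAtMost D E →
    SucceedsWhp (A n) (½ - ε) E)
-- At most a fraction 2 / a of the seeds is bad, so a = 200 gives failure probability at most 1/100.
theorem1p1 D ε pos = streaming-for D 200 ≤-refl ε pos (ascent-parameters (ℚ.denominatorℕ ε) D)
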